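{- For integers $\nu\ge1$ and $n\ge(\nu+1)^2$, \[ (-1)^\nu\left(\overline{p}(n)+2\sum_{\tau=1}^{\nu}(-1)^\tau\overline{p}(n-\tau^2)\right)=2\,\overline{p}(1,2,\nu;n). \]
   Context: An overpartition of $n$ is a partition of $n$ in which the first occurrence of each distinct part may be overlined; $\overline{p}(n)$ is the number of overpartitions of $n$. Definition of $M(a,m,\nu;n)$ (integers $\nu\ge0$, $1\le a<m$, $n\ge0$): for a partition $\lambda_1\ge\dots\ge\lambda_k$ of $n$ into parts $\equiv a\pmod m$, put $\ell_i=(\lambda_i-a)/m+1$ (number of boxes of the row of $\lambda_i$ in the $m$-modular Young diagram), and let $t$ be the largest integer $0\le t\le k$ with $\ell_t\ge t+\nu+2$ (height of the $(\nu+2)$-Durfee rectangle, of width $t+\nu+2$). $M(a,m,\nu;n)$ counts partitions of $n$ into parts $\equiv a\pmod m$ in which each of $a,a+m,\dots,a+m\nu$ occurs at least once and $\ell_i<t+\nu+2$ for all $i>t$. Definition: $\overline{p}(1,2,\nu;n)$ counts overpartitions of $n$ such that, if $\alpha$ is the sum of all parts other than the non-overlined odd parts, the non-overlined odd parts form a partition counted by $M(1,2,\nu;n-\alpha)$. -}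

module Defs where

open import Data.Bool using (Bool; true; false; _∧_; _∨_; not; T)
open import Data.Nat using (ℕ; zero; suc; _+_; _*_; _∸_; _≤ᵇ_; _<ᵇ_; _≡ᵇ_; NonZero; _⊔_)
open import Data.Nat.DivMod using (_/_; _%_)
open import Data.List using (List; []; _∷_; length; map; concatMap; upTo; filter; zip; foldr; cartesianProduct)
open import Data.Nat.ListAction using (sum)
open import Data.Bool.ListAction using (all; any)
open import Data.Product using (_×_; _,_; proj₁; proj₂)
open import Relation.Nullary.Decidable using (T?)

listsOf : {A : Set} → List A → ℕ → List (List A)
listsOf xs zero    = [] ∷ []
listsOf xs (suc k) = concatMap (λ x → map (x ∷_) (listsOf xs k)) xs

listsUpTo : {A : Set} → List A → ℕ → List (List A)
listsUpTo xs n = concatMap (listsOf xs) (upTo (suc n))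

count : {A : Set} → (A → Bool) → List A → ℕ
count p xs = length (filter (λ x → T? (p x)) xs)

nonincr : List ℕ → Bool
nonincr []           = true
nonincr (x ∷ [])     = true
nonincr (x ∷ y ∷ ys) = (y ≤ᵇ x) ∧ nonincr (y ∷ ys)

isPartition : ℕ → List ℕ → Bool
isPartition n ps = all (λ x → 1 ≤ᵇ x) ps ∧ nonincr ps ∧ (sum ps ≡ᵇ n)

partitionCands : ℕ → List (List ℕ)
partitionCands n = listsUpTo (upTo (suc n)) n

-- Overpartitions: a part is a pair (size , overlined?).
-- Canonical form: sizes nonincreasing; among equal sizes only the first
-- copy may be overlined (a part followed by an equal part forces the
-- follower to be non-overlined).

ordOP : List (ℕ × Bool) → Bool
ordOP []           = true
ordOP (p ∷ [])     = true
ordOP (p ∷ q ∷ qs) =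
  ((proj₁ q <ᵇ proj₁ p) ∨ ((proj₁ q ≡ᵇ proj₁ p) ∧ not (proj₂ q))) ∧ ordOP (q ∷ qs)

isOverpartition : ℕ → List (ℕ × Bool) → Bool
isOverpartition n π = all (λ x → 1 ≤ᵇ proj₁ x) π ∧ ordOP π ∧ (sum (map proj₁ π) ≡ᵇ n)

overpartitionCands : ℕ → List (List (ℕ × Bool))
overpartitionCands n = listsUpTo (cartesianProduct (upTo (suc n)) (false ∷ true ∷ [])) n

pbar : ℕ → ℕ
pbar n = count (isOverpartition n) (overpartitionCands n)

-- number of boxes of the row of part x in the m-modular Young diagram
ell : (a m : ℕ) → .{{NonZero m}} → ℕ → ℕ
ell a m x = (x ∸ a) / m + 1

indexedRows : (a m : ℕ) → .{{NonZero m}} → List ℕ → List (ℕ × ℕ)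
indexedRows a m ps = zip (map suc (upTo (length ps))) (map (ell a m) ps)

durfeeHeight : (a m : ℕ) → .{{NonZero m}} → ℕ → List ℕ → ℕ
durfeeHeight a m ν ps =
  foldr _⊔_ 0 (map proj₁ (filter (λ il → T? ((proj₁ il + ν + 2) ≤ᵇ proj₂ il)) (indexedRows a m ps)))

isM : (a m : ℕ) → .{{NonZero m}} → ℕ → ℕ → List ℕ → Bool
isM a m ν N ps =
  isPartition N ps
  ∧ all (λ x → x % m ≡ᵇ a) ps
  ∧ all (λ j → any (λ x → x ≡ᵇ (a + m * j)) ps) (upTo (suc ν))
  ∧ all (λ il → (proj₁ il ≤ᵇ t) ∨ (proj₂ il <ᵇ (t + ν + 2))) (indexedRows a m ps)
  where t = durfeeHeight a m ν ps

M : (a m : ℕ) → .{{NonZero m}} → ℕ → ℕ → ℕ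
M a m ν N = count (isM a m ν N) (partitionCands N)

isOdd : ℕ → Bool
isOdd x = x % 2 ≡ᵇ 1

nonOvOdd : ℕ × Bool → Bool
nonOvOdd p = not (proj₂ p) ∧ isOdd (proj₁ p)

isPbar12 : ℕ → ℕ → List (ℕ × Bool) → Bool
isPbar12 ν n π =
  isOverpartition n π
  ∧ isM 1 2 ν (n ∸ α) (map proj₁ (filter (λ p → T? (nonOvOdd p)) π))
  where α = sum (map proj₁ (filter (λ p → T? (not (nonOvOdd p))) π))

pbar12 : ℕ → ℕ → ℕ
pbar12 ν n = count (isPbar12 ν n) (overpartitionCands n)

{-# OPTIONS --safe #-}
module Submission where

-- An overpartition is a pair (ρ, λ), where λ consists of the non-overlined odd parts, written
-- 1 + 2x₀ ≥ 1 + 2x₁ ≥ …  Say that x meets s if xₜ = s + t for some t and avoids s otherwise,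
-- and let a(s,n), b(s,n) count the overpartitions of n avoiding resp. meeting s; thus
-- p̄(n) = a(s,n) + b(s,n).  Removing one copy of each of 1, 3, …, 2ν+1 gives
-- p̄(1,2,ν;n) = a(ν+1, n-(ν+1)²), and deleting the entry xₜ = s + t while raising the t
-- entries before it by 1 gives b(s,n) = a(s+1, n-2s-1).  Hence
-- p̄(1,2,ν;n) = b(ν, n-ν²) = p̄(n-ν²) - b(ν-1, n-(ν-1)²), and the theorem follows by induction
-- from 2b(0,n) = p̄(n) for n ≥ 1.
--
-- For this last identity, splitting each even non-overlined part into two equal halves turns
-- ρ (halves and overlined parts) into an arbitrary partition μ, and the Durfee decomposition
-- turns λ into a partition δ into distinct parts, evenly many of them exactly when λ avoids 0.
-- Moving the largest part between μ and δ is an involution that changes this parity.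

open import Defs
open import Data.Nat using (ℕ; suc; _≤_; _∸_; _^_)
open import Data.List using (map; upTo; foldr)
open import Relation.Binary.PropositionalEquality using (_≡_)

module Overpartitions where

  open import Data.Bool using (Bool; true; false; T; _∧_; _∨_; not)
  open import Data.Bool.ListAction using (all; any)
  open import Data.Bool.Properties using (T-∧; T-∨; not-involutive)
  open import Data.Unit using (⊤; tt)
  open import Data.Nat using (zero; pred; _+_; _*_; _⊔_; _<_; _>_; _≥_; z≤n; s≤s; s≤s⁻¹; _≤?_; _≥?_; _<?_; _≟_; _≤ᵇ_; _<ᵇ_; _≡ᵇ_)
  open import Data.Nat.Properties hiding (_≤?_; _≥?_; _<?_; _≟_)
  open import Data.Nat.DivMod using (_/_; _%_; m≡m%n+[m/n]*n; m%n<n; m*n/n≡m; [m+kn]%n≡m%n; m*n%n≡0)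
  open import Data.Nat.ListAction using (sum)
  open import Data.Nat.ListAction.Properties using (sum-++; sum-↭)
  open import Data.Nat.Solver using (module +-*-Solver)
  open import Data.List using (List; []; _∷_; _++_; length; replicate; filter; merge; zip; concat; applyUpTo; cartesianProductWith)
  open import Data.List.Properties using (∷-injective; length-++; length-map; length-replicate; map-++; map-∘; map-cong; map-id; map-injective; filter-all; filter-none; filter-accept; filter-reject)
  open import Data.List.Membership.Propositional using (_∈_)
  open import Data.List.Membership.Propositional.Properties using (∈-∃++; ∈-++⁻; ∈-++⁺ˡ; ∈-++⁺ʳ; ∈-filter⁺; ∈-filter⁻; ∈-concat⁺′; ∈-map⁺; ∈-upTo⁺; ∈-upTo⁻; ∈-cartesianProductWith⁺; ∈-cartesianProductWith⁻; ∈-cartesianProduct⁺)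
  open import Data.List.Relation.Unary.Any as Any using (here; there)
  import Data.List.Relation.Unary.Any.Properties as Anyₚ
  open import Data.List.Relation.Unary.All as All using (All; []; _∷_)
  import Data.List.Relation.Unary.All.Properties as Allₚ
  open import Data.List.Relation.Unary.AllPairs as AllPairs using (AllPairs; []; _∷_)
  import Data.List.Relation.Unary.AllPairs.Properties as AllPairsₚ
  open import Data.List.Relation.Unary.Linked using (Linked; []; [-]; _∷_)
  open import Data.List.Relation.Unary.Linked.Properties using (Linked⇒AllPairs; AllPairs⇒Linked)
  open import Data.List.Relation.Unary.Unique.Propositional using (Unique)
  import Data.List.Relation.Unary.Unique.Propositional.Properties as Uniqueₚ
  open import Data.List.Relation.Binary.Disjoint.Propositional using (Disjoint)
  open import Data.List.Relation.Binary.Permutation.Propositional using (_↭_; ↭-refl; ↭-sym; ↭-trans; prep; swap)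
  open import Data.List.Relation.Binary.Permutation.Propositional.Properties using (shift; ↭-length; merge-↭; map⁺; ∈-resp-↭; All-resp-↭)
  open import Data.Product using (_×_; _,_; proj₁; proj₂; ∃; uncurry)
  open import Data.Sum as Sum using (_⊎_; inj₁; inj₂)
  open import Function using (_∘_; Equivalence)
  open import Relation.Nullary using (Dec; yes; no; ¬_; contradiction)
  open import Relation.Nullary.Decidable using (T?; isYes; toWitness; fromWitness; toWitnessFalse; fromWitnessFalse)
  import Relation.Unary as U
  open import Relation.Binary.Definitions using (Transitive; Decidable; tri<; tri≈; tri>)
  open import Relation.Binary.PropositionalEquality using (_≢_; refl; sym; trans; cong; cong₂; subst; module ≡-Reasoning)
  open +-*-Solver using (solve; _:=_; _:+_; _:*_; con)

  -- Bijections between predicates, given as relations.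

  infix 4 _≅_

  -- A relation instead of a pair of functions keeps the notion symmetric, so inverses come for
  -- free, and it suits correspondences such as `Split` and `Move` that are defined inductively.
  record _≅_ {X Y : Set} (P : X → Set) (Q : Y → Set) : Set₁ where
    field
      rel        : X → Y → Set
      total      : ∀ {x} → P x → ∃ λ y → Q y × rel x y
      onto       : ∀ {y} → Q y → ∃ λ x → P x × rel x y
      injective  : ∀ {x x′ y} → rel x y → rel x′ y → x ≡ x′
      functional : ∀ {x y y′} → rel x y → rel x y′ → y ≡ y′

  ≅-sym : {X Y : Set} {P : X → Set} {Q : Y → Set} → P ≅ Q → Q ≅ P
  ≅-sym b = record
    { rel = λ y x → rel x y ; total = onto ; onto = total
    ; injective = functional ; functional = injective }
    where open _≅_ b

  ≅-trans : {X Y Z : Set} {P : X → Set} {Q : Y → Set} {R : Z → Set} → P ≅ Q → Q ≅ R → P ≅ R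
  ≅-trans b c = record
    { rel        = λ x z → ∃ λ y → B.rel x y × C.rel y z
    ; total      = λ p → let y , q , xy = B.total p ; z , r , yz = C.total q in z , r , y , xy , yz
    ; onto       = λ r → let y , q , yz = C.onto r ; x , p , xy = B.onto q in x , p , y , xy , yz
    ; injective  = λ where
        (y , xy , yz) (y′ , xy′ , yz′) → B.injective xy (subst (B.rel _) (C.injective yz′ yz) xy′)
    ; functional = λ where
        (y , xy , yz) (y′ , xy′ , yz′) → C.functional yz (subst (λ v → C.rel v _) (B.functional xy′ xy) yz′)
    }
    where module B = _≅_ b
          module C = _≅_ c

  fromFunction : {X Y : Set} {P : X → Set} {Q : Y → Set} (f : X → Y) →
    (∀ {x} → P x → Q (f x)) →
    (∀ {x x′} → P x → P x′ → f x ≡ f x′ → x ≡ x′) →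
    (∀ {y} → Q y → ∃ λ x → P x × f x ≡ y) → P ≅ Q
  fromFunction {P = P} f f-ok f-inj f-onto = record
    -- `P x` is part of the relation because `f` need only be injective on `P`, whereas the field
    -- `injective` asks for no membership.
    { rel        = λ x y → P x × f x ≡ y
    ; total      = λ {x} p → f x , f-ok p , p , refl
    ; onto       = λ q → let x , p , e = f-onto q in x , p , p , e
    ; injective  = λ (p , e) (p′ , e′) → f-inj p p′ (trans e (sym e′))
    ; functional = λ (p , e) (p′ , e′) → trans (sym e) e′
    }

  -- Counting along bijections.

  length-mono : {X Y : Set} (_~_ : X → Y → Set) → (∀ {x x′ y} → x ~ y → x′ ~ y → x ≡ x′) →
    ∀ {xs ys} → Unique xs → (∀ {x} → x ∈ xs → ∃ λ y → y ∈ ys × x ~ y) → length xs ≤ length ys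
  length-mono _~_ ~-inj [] _ = z≤n
  length-mono _~_ ~-inj {x ∷ xs} (x∉ ∷ u) match with match (here refl)
  ... | y , y∈ , x~y with ∈-∃++ y∈
  -- Pigeonhole: the partner of x is cut out of `ys`, and injectivity keeps the partners of the
  -- other entries away from it.
  ... | as , bs , refl =
    subst (suc (length xs) ≤_) (sym (↭-length (shift y as bs))) (s≤s (length-mono _~_ ~-inj u match′))
    where
    match′ : ∀ {x′} → x′ ∈ xs → ∃ λ y′ → y′ ∈ as ++ bs × x′ ~ y′
    match′ x′∈ with match (there x′∈)
    ... | y′ , y′∈ , x′~y′ with ∈-++⁻ as y′∈
    ...   | inj₁ m = y′ , ∈-++⁺ˡ m , x′~y′
    ...   | inj₂ (here refl) = contradiction (~-inj x~y x′~y′) (All.lookup x∉ x′∈)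
    ...   | inj₂ (there m) = y′ , ∈-++⁺ʳ as m , x′~y′

  -- Completeness of `ys` for `q` places the partner of a counted element in the filtered list;
  -- uniqueness of `xs` prevents counting an element twice.
  count-mono : {X Y : Set} {p : X → Bool} {q : Y → Bool} {xs : List X} {ys : List Y} →
    Unique xs → (∀ {y} → T (q y) → y ∈ ys) → (T ∘ p) ≅ (T ∘ q) → count p xs ≤ count q ys
  count-mono {p = p} {q} {xs} u all-q b =
    length-mono rel injective (Uniqueₚ.filter⁺ (T? ∘ p) u) λ x∈ →
      let y , qy , xy = total (proj₂ (∈-filter⁻ (T? ∘ p) {xs = xs} x∈))
      in y , ∈-filter⁺ (T? ∘ q) (all-q qy) qy , xy
    where open _≅_ b

  count-cong : {X Y : Set} {p : X → Bool} {q : Y → Bool} {xs : List X} {ys : List Y} →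
    Unique xs → Unique ys → (∀ {x} → T (p x) → x ∈ xs) → (∀ {y} → T (q y) → y ∈ ys) →
    (T ∘ p) ≅ (T ∘ q) → count p xs ≡ count q ys
  count-cong ux uy all-p all-q b =
    ≤-antisym (count-mono ux all-q b) (count-mono uy all-p (≅-sym b))

  count-split : {X : Set} (p d : X → Bool) (xs : List X) →
    count p xs ≡ count (λ x → p x ∧ d x) xs + count (λ x → p x ∧ not (d x)) xs
  count-split p d [] = refl
  count-split p d (x ∷ xs) with p x | d x
  ... | false | _     = count-split p d xs
  ... | true  | true  = cong suc (count-split p d xs)
  ... | true  | false = trans (cong suc (count-split p d xs)) (sym (+-suc _ _))

  -- Enumeration of candidate lists.

  module _ {X : Set} (xs : List X) where

    concatMap-∷ : (zs : List X) (yss : List (List X)) →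
      concat (map (λ x → map (x ∷_) yss) zs) ≡ cartesianProductWith _∷_ zs yss
    concatMap-∷ []       yss = refl
    concatMap-∷ (z ∷ zs) yss = cong (map (z ∷_) yss ++_) (concatMap-∷ zs yss)

    listsOf-suc : ∀ k → listsOf xs (suc k) ≡ cartesianProductWith _∷_ xs (listsOf xs k)
    listsOf-suc k = concatMap-∷ xs (listsOf xs k)

    listsOf-complete : ∀ {ys} → All (_∈ xs) ys → ys ∈ listsOf xs (length ys)
    listsOf-complete [] = here refl
    listsOf-complete {y ∷ ys} (y∈ ∷ ys∈) rewrite listsOf-suc (length ys) =
      ∈-cartesianProductWith⁺ _∷_ y∈ (listsOf-complete ys∈)

    listsOf-length : ∀ k {ys} → ys ∈ listsOf xs k → length ys ≡ k
    listsOf-length zero (here refl) = refl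
    listsOf-length (suc k) ys∈ rewrite listsOf-suc k
      with ∈-cartesianProductWith⁻ _∷_ xs (listsOf xs k) ys∈
    ... | _ , _ , _ , zs∈ , refl = cong suc (listsOf-length k zs∈)

    listsOf-unique : Unique xs → ∀ k → Unique (listsOf xs k)
    listsOf-unique u zero = [] ∷ []
    listsOf-unique u (suc k) rewrite listsOf-suc k =
      Uniqueₚ.cartesianProductWith⁺ _∷_ ∷-injective u (listsOf-unique u k)

    listsUpTo-complete : ∀ {n ys} → All (_∈ xs) ys → length ys ≤ n → ys ∈ listsUpTo xs n
    listsUpTo-complete ys∈ len =
      ∈-concat⁺′ (listsOf-complete ys∈) (∈-map⁺ (listsOf xs) (∈-upTo⁺ (s≤s len)))

    listsUpTo-unique : Unique xs → ∀ n → Unique (listsUpTo xs n)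
    listsUpTo-unique u n = Uniqueₚ.concat⁺
      (Allₚ.map⁺ (All.universal (listsOf-unique u) (upTo (suc n))))
      -- Lists of different lengths cannot coincide, so the blocks of the concatenation are
      -- disjoint.
      (AllPairsₚ.map⁺ (AllPairs.map disjoint (Uniqueₚ.upTo⁺ (suc n))))
      where
      disjoint : ∀ {i j} → i ≢ j → Disjoint (listsOf xs i) (listsOf xs j)
      disjoint i≢j (∈i , ∈j) = i≢j (trans (sym (listsOf-length _ ∈i)) (listsOf-length _ ∈j))

  overpartitionCands-unique : ∀ n → Unique (overpartitionCands n)
  overpartitionCands-unique n = listsUpTo-unique _
    (Uniqueₚ.cartesianProduct⁺ (Uniqueₚ.upTo⁺ (suc n)) (((λ ()) ∷ []) ∷ [] ∷ [])) n

  size : List (ℕ × Bool) → ℕ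
  size π = sum (map proj₁ π)

  Positive : ℕ × Bool → Set
  Positive p = 1 ≤ proj₁ p

  length≤size : ∀ {π} → All Positive π → length π ≤ size π
  length≤size [] = z≤n
  length≤size (p ∷ ps) = +-mono-≤ p (length≤size ps)

  parts≤size : ∀ π → All (λ p → proj₁ p ≤ size π) π
  parts≤size [] = []
  parts≤size (p ∷ π) = m≤m+n _ _ ∷ All.map (λ le → ≤-trans le (m≤n+m _ _)) (parts≤size π)

  -- Positive parts number at most their total, and no size exceeds it, so both bounds of the
  -- enumeration are met.
  overpartitionCands-complete : ∀ {n π} → All Positive π → size π ≡ n → π ∈ overpartitionCands n
  overpartitionCands-complete {π = π} pos refl = listsUpTo-complete _
    (All.map (λ {p} le → ∈-cartesianProduct⁺ (∈-upTo⁺ (s≤s le)) (∈-bools (proj₂ p))) (parts≤size π))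
    (length≤size pos)
    where
    ∈-bools : ∀ b → b ∈ false ∷ true ∷ []
    ∈-bools false = here refl
    ∈-bools true  = there (here refl)

  -- Decreasing lists of indices for odd parts.

  Decreasing : List ℕ → Set
  Decreasing = AllPairs _≥_

  oddPart : ℕ → ℕ
  oddPart x = 1 + 2 * x

  oddSum : List ℕ → ℕ
  oddSum xs = sum (map oddPart xs)

  oddSum-++ : ∀ xs ys → oddSum (xs ++ ys) ≡ oddSum xs + oddSum ys
  oddSum-++ xs ys = trans (cong sum (map-++ oddPart xs ys)) (sum-++ (map oddPart xs) (map oddPart ys))

  -- For a decreasing list x₀ ≥ x₁ ≥ … exactly one of two things happens: Meets s, where
  -- xₜ = s + t for some t, or Avoids s, where for some t exactly t entries are ≥ s + t.
  -- With parts 1 + 2xᵢ and s = ν + 1 the latter is the Durfee condition in M(1,2,ν;·).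

  data Avoids (s : ℕ) : List ℕ → Set where
    end   : Avoids s []
    below : ∀ {x xs} → x < s → Avoids s (x ∷ xs)
    above : ∀ {x xs} → s < x → Avoids (suc s) xs → Avoids s (x ∷ xs)

  data Meets (s : ℕ) : List ℕ → Set where
    now   : ∀ {xs} → Meets s (s ∷ xs)
    later : ∀ {x xs} → s < x → Meets (suc s) xs → Meets s (x ∷ xs)

  avoids-or-meets : ∀ s xs → Avoids s xs ⊎ Meets s xs
  avoids-or-meets s [] = inj₁ end
  avoids-or-meets s (x ∷ xs) with <-cmp x s
  ... | tri< x<s _ _  = inj₁ (below x<s)
  ... | tri≈ _ refl _ = inj₂ now
  ... | tri> _ _ s<x with avoids-or-meets (suc s) xs
  ...   | inj₁ a = inj₁ (above s<x a)
  ...   | inj₂ m = inj₂ (later s<x m)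

  meets⇒¬avoids : ∀ {s xs} → Meets s xs → ¬ Avoids s xs
  meets⇒¬avoids now           (below s<s)     = <-irrefl refl s<s
  meets⇒¬avoids now           (above s<s _)   = <-irrefl refl s<s
  meets⇒¬avoids (later s<x _) (below x<s)     = <-asym s<x x<s
  meets⇒¬avoids (later _ m)   (above _ a)     = meets⇒¬avoids m a

  avoids? : ∀ s xs → Dec (Avoids s xs)
  avoids? s xs with avoids-or-meets s xs
  ... | inj₁ a = yes a
  ... | inj₂ m = no (meets⇒¬avoids m)

  -- The bijection from avoiding s + 1 to meeting s.

  -- If t is the number of entries that Avoids (suc s) passes with `above`, they lose 1 each
  -- and the entry s + t is placed right behind them: the odd sum grows by
  -- (1 + 2(s + t)) - 2t = 1 + 2s.

  hit : ℕ → List ℕ → List ℕ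
  hit s [] = s ∷ []
  hit s (y ∷ ys) with y ≤? s
  ... | yes _ = s ∷ y ∷ ys
  ... | no  _ = pred y ∷ hit (suc s) ys

  unhit : ℕ → List ℕ → List ℕ
  unhit s [] = []
  unhit s (x ∷ xs) with x ≟ s
  ... | yes _ = xs
  ... | no  _ = suc x ∷ unhit (suc s) xs

  hit-oddSum : ∀ {s ys} → Avoids (suc s) ys → oddSum (hit s ys) ≡ oddPart s + oddSum ys
  hit-oddSum end = refl
  -- The test in `hit` matches the constructors: `below` means y ≤ s, while `above` means y ≥ s + 2,
  -- which also makes `pred y` a true subtraction.
  hit-oddSum {s} {y ∷ ys} a with y ≤? s | a
  ... | yes _   | _ = refl
  ... | no y≰s | below (s≤s y≤s) = contradiction y≤s y≰s
  ... | no _ | above (s≤s {n = y′} _) a′ = trans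
    (cong (oddPart y′ +_) (hit-oddSum a′))
    (solve 3 (λ y s o → con 1 :+ con 2 :* y :+ (con 1 :+ con 2 :* (con 1 :+ s) :+ o)
                     := con 1 :+ con 2 :* s :+ (con 1 :+ con 2 :* (con 1 :+ y) :+ o))
             refl y′ s (oddSum ys))

  -- This is the head condition for sortedness of `hit`. An entry that is passed and loses 1 is
  -- still at least the next candidate `suc s`, and the untouched entries lie below the new one.
  hit-bounded : ∀ {s b ys} → Decreasing ys → All (_≤ suc b) ys → s ≤ b → Avoids (suc s) ys → All (_≤ b) (hit s ys)
  hit-bounded _ _ s≤b end = s≤b ∷ []
  hit-bounded {s} {b} {y ∷ ys} (y≥ ∷ dec) (y≤ ∷ ys≤) s≤b a with y ≤? s | a
  ... | yes y≤s | _ = s≤b ∷ ≤-trans y≤s s≤b ∷ All.map (λ z≤y → ≤-trans z≤y (≤-trans y≤s s≤b)) y≥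
  ... | no y≰s | below (s≤s y≤s) = contradiction y≤s y≰s
  ... | no _ | above (s≤s s<y′) a′ =
    s≤s⁻¹ y≤ ∷ hit-bounded dec ys≤ (≤-trans s<y′ (s≤s⁻¹ y≤)) a′

  hit-bounded⁻ : ∀ {b} s ys → All (_≤ b) (hit s ys) → All (_≤ suc b) ys
  hit-bounded⁻ s [] _ = []
  hit-bounded⁻ s (y ∷ ys) bs with y ≤? s | bs
  ... | yes _ | _ ∷ bs′ = All.map m≤n⇒m≤1+n bs′
  ... | no _  | b ∷ bs′ = ≤-trans (suc-pred-≤ y) (s≤s b) ∷ hit-bounded⁻ (suc s) ys bs′
    where
    suc-pred-≤ : ∀ n → n ≤ suc (pred n)
    suc-pred-≤ zero    = z≤n
    suc-pred-≤ (suc n) = ≤-refl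

  hit-decreasing : ∀ {s ys} → Decreasing ys → Avoids (suc s) ys → Decreasing (hit s ys)
  hit-decreasing _ end = [] ∷ []
  hit-decreasing {s} {y ∷ ys} (y≥ ∷ dec) a with y ≤? s | a
  ... | yes y≤s | _ = (y≤s ∷ All.map (λ z≤y → ≤-trans z≤y y≤s) y≥) ∷ y≥ ∷ dec
  ... | no y≰s | below (s≤s y≤s) = contradiction y≤s y≰s
  ... | no _ | above (s≤s s<y′) a′ = hit-bounded dec y≥ s<y′ a′ ∷ hit-decreasing dec a′

  hit-meets : ∀ {s ys} → Avoids (suc s) ys → Meets s (hit s ys)
  hit-meets end = now
  hit-meets {s} {y ∷ ys} a with y ≤? s | a
  ... | yes _ | _ = now
  ... | no y≰s | below (s≤s y≤s) = contradiction y≤s y≰s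
  ... | no _ | above (s≤s s<y′) a′ = later s<y′ (hit-meets a′)

  unhit-now : ∀ s xs → unhit s (s ∷ xs) ≡ xs
  unhit-now s xs with s ≟ s
  ... | yes _  = refl
  ... | no s≢s = contradiction refl s≢s

  unhit-later : ∀ {s x} xs → s < x → unhit s (x ∷ xs) ≡ suc x ∷ unhit (suc s) xs
  unhit-later {s} {x} xs s<x with x ≟ s
  ... | yes x≡s = contradiction (sym x≡s) (<⇒≢ s<x)
  ... | no _ = refl

  unhit-hit : ∀ {s ys} → Avoids (suc s) ys → unhit s (hit s ys) ≡ ys
  unhit-hit {s} end = unhit-now s []
  unhit-hit {s} {y ∷ ys} a with y ≤? s | a
  ... | yes _ | _ = unhit-now s (y ∷ ys)
  ... | no y≰s | below (s≤s y≤s) = contradiction y≤s y≰s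
  ... | no _ | above (s≤s s<y′) a′ =
    trans (unhit-later (hit (suc s) ys) s<y′) (cong (_ ∷_) (unhit-hit a′))

  -- Backwards, the meeting entry is dropped and those before it regain 1. Sortedness bounds what
  -- follows the entry s by s, hence below s + 1; for the raised entries x > s becomes
  -- `suc x > suc s`.
  hit-onto : ∀ {s xs} → Decreasing xs → Meets s xs → ∃ λ ys → Decreasing ys × Avoids (suc s) ys × hit s ys ≡ xs
  hit-onto {s} (_∷_ {xs = []} _ _) now = [] , [] , end , refl
  hit-onto {s} (_∷_ {xs = y ∷ ys} (y≤s ∷ _) dec) now = y ∷ ys , dec , below (s≤s y≤s) , stop
    where
    stop : hit s (y ∷ ys) ≡ s ∷ y ∷ ys
    stop with y ≤? s
    ... | yes _  = refl
    ... | no y≰s = contradiction y≤s y≰s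
  hit-onto {s} {x ∷ xs} (x≥ ∷ dec) (later s<x m) with hit-onto dec m
  ... | ys , dec′ , a , refl =
    suc x ∷ ys , hit-bounded⁻ (suc s) ys x≥ ∷ dec′ , above (s≤s s<x) a , go
    where
    go : hit s (suc x ∷ ys) ≡ x ∷ hit (suc s) ys
    go with suc x ≤? s
    ... | yes x<s = contradiction (<-trans x<s s<x) (<-irrefl refl)
    ... | no _    = refl

  -- Inserting the parts 1, 3, ..., 2s - 1.

  insert : ℕ → List ℕ → List ℕ
  insert y [] = y ∷ []
  insert y (x ∷ xs) with y ≥? x
  ... | yes _ = y ∷ x ∷ xs
  ... | no  _ = x ∷ insert y xs

  insert-↭ : ∀ y xs → insert y xs ↭ y ∷ xs
  insert-↭ y [] = ↭-refl
  insert-↭ y (x ∷ xs) with y ≥? x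
  ... | yes _ = ↭-refl
  ... | no  _ = ↭-trans (prep x (insert-↭ y xs)) (swap x y ↭-refl)

  insert-oddSum : ∀ y xs → oddSum (insert y xs) ≡ oddPart y + oddSum xs
  insert-oddSum y xs = sum-↭ (map⁺ oddPart (insert-↭ y xs))

  insert-decreasing : ∀ y {xs} → Decreasing xs → Decreasing (insert y xs)
  insert-decreasing y [] = [] ∷ []
  insert-decreasing y {x ∷ xs} (x≥ ∷ dec) with y ≥? x
  ... | yes y≥x = (y≥x ∷ All.map (λ z≤x → ≤-trans z≤x y≥x) x≥) ∷ x≥ ∷ dec
  ... | no y≱x  = All-resp-↭ (↭-sym (insert-↭ y xs)) (<⇒≤ (≰⇒> y≱x) ∷ x≥) ∷ insert-decreasing y dec

  -- The head of the result reveals the branch taken: it is y after an insertion in front, and an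
  -- entry larger than y otherwise.
  insert-injective : ∀ y {xs zs} → insert y xs ≡ insert y zs → xs ≡ zs
  insert-injective y {[]} {[]} _ = refl
  insert-injective y {[]} {z ∷ zs} e with y ≥? z
  insert-injective y {[]} {z ∷ zs} () | yes _
  insert-injective y {[]} {z ∷ zs} e | no y≱z = contradiction (≤-reflexive (sym (proj₁ (∷-injective e)))) y≱z
  insert-injective y {x ∷ xs} {[]} e with y ≥? x
  insert-injective y {x ∷ xs} {[]} () | yes _
  insert-injective y {x ∷ xs} {[]} e | no y≱x = contradiction (≤-reflexive (proj₁ (∷-injective e))) y≱x
  insert-injective y {x ∷ xs} {z ∷ zs} e with y ≥? x | y ≥? z
  ... | yes _   | yes _   = proj₂ (∷-injective e)
  ... | yes _   | no y≱z  = contradiction (≤-reflexive (sym (proj₁ (∷-injective e)))) y≱z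
  ... | no y≱x  | yes _   = contradiction (≤-reflexive (proj₁ (∷-injective e))) y≱x
  ... | no _    | no _    = cong₂ _∷_ (proj₁ (∷-injective e)) (insert-injective y (proj₂ (∷-injective e)))

  insert-head : ∀ {y xs} → All (_≤ y) xs → insert y xs ≡ y ∷ xs
  insert-head [] = refl
  insert-head {y} {x ∷ xs} (x≤y ∷ _) with y ≥? x
  ... | yes _  = refl
  ... | no y≱x = contradiction x≤y y≱x

  insert-onto : ∀ {y xs} → Decreasing xs → y ∈ xs → ∃ λ zs → Decreasing zs × insert y zs ≡ xs
  insert-onto {xs = x ∷ xs} (x≥ ∷ dec) (here refl) = xs , dec , insert-head x≥
  insert-onto {y} {x ∷ xs} (x≥ ∷ dec) (there y∈) with y ≥? x
  -- A later copy of y under a head x ≤ y forces x = y, so the head can serve as the copy to remove.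
  ... | yes y≥x with ≤-antisym y≥x (All.lookup x≥ y∈)
  ...   | refl = xs , dec , insert-head x≥
  insert-onto {y} {x ∷ xs} (x≥ ∷ dec) (there y∈) | no y≱x with insert-onto dec y∈
  ... | zs , dec′ , refl = x ∷ zs , All.tail (All-resp-↭ (insert-↭ y zs) x≥) ∷ dec′ , go
    where
    go : insert y (x ∷ zs) ≡ x ∷ insert y zs
    go with y ≥? x
    ... | yes y≥x = contradiction y≥x y≱x
    ... | no _    = refl

  -- Entries passed with `above` exceed the threshold and hence y, so y lands behind all of them and
  -- at most becomes the new stopping entry.
  insert-avoids : ∀ {y s xs} → y < s → Avoids s xs → Avoids s (insert y xs)
  insert-avoids y<s end = below y<s
  insert-avoids {y} {xs = x ∷ xs} y<s a with y ≥? x | a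
  ... | yes _ | _           = below y<s
  ... | no _  | below x<s   = below x<s
  ... | no _  | above s<x b = above s<x (insert-avoids (m<n⇒m<1+n y<s) b)

  insert-avoids⁻ : ∀ {y s} xs → y < s → Avoids s (insert y xs) → Avoids s xs
  insert-avoids⁻ [] _ _ = end
  insert-avoids⁻ {y} (x ∷ xs) y<s a with y ≥? x | a
  ... | yes x≤y | _           = below (≤-<-trans x≤y y<s)
  ... | no _    | below x<s   = below x<s
  ... | no _    | above s<x b = above s<x (insert-avoids⁻ xs (m<n⇒m<1+n y<s) b)

  insertBelow : ℕ → List ℕ → List ℕ
  insertBelow zero    xs = xs
  insertBelow (suc s) xs = insert s (insertBelow s xs)

  insertBelow-oddSum : ∀ s xs → oddSum (insertBelow s xs) ≡ s * s + oddSum xs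
  insertBelow-oddSum zero    xs = refl
  insertBelow-oddSum (suc s) xs = trans (insert-oddSum s (insertBelow s xs)) (trans
    (cong (oddPart s +_) (insertBelow-oddSum s xs))
    (solve 2 (λ s o → con 1 :+ con 2 :* s :+ (s :* s :+ o) := (con 1 :+ s) :* (con 1 :+ s) :+ o)
             refl s (oddSum xs)))

  insertBelow-decreasing : ∀ s {xs} → Decreasing xs → Decreasing (insertBelow s xs)
  insertBelow-decreasing zero    dec = dec
  insertBelow-decreasing (suc s) dec = insert-decreasing s (insertBelow-decreasing s dec)

  insertBelow-injective : ∀ s {xs zs} → insertBelow s xs ≡ insertBelow s zs → xs ≡ zs
  insertBelow-injective zero    e = e
  insertBelow-injective (suc s) e = insertBelow-injective s (insert-injective s e)

  insertBelow-∈ : ∀ s xs {j} → j < s → j ∈ insertBelow s xs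
  insertBelow-∈ (suc s) xs {j} j<1+s = ∈-resp-↭ (↭-sym (insert-↭ s (insertBelow s xs))) mem
    where
    mem : j ∈ s ∷ insertBelow s xs
    mem with j ≟ s
    ... | yes refl = here refl
    ... | no j≢s   = there (insertBelow-∈ s xs (≤∧≢⇒< (s≤s⁻¹ j<1+s) j≢s))

  insertBelow-onto : ∀ s {xs} → Decreasing xs → (∀ {j} → j < s → j ∈ xs) →
    ∃ λ zs → Decreasing zs × insertBelow s zs ≡ xs
  insertBelow-onto zero {xs} dec _ = xs , dec , refl
  insertBelow-onto (suc s) dec has with insert-onto dec (has ≤-refl)
  ... | ys , dec′ , refl with insertBelow-onto s dec′ has′
    where
    has′ : ∀ {j} → j < s → j ∈ ys
    -- Taking one s away loses no smaller index, since j ≠ s.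
    has′ {j} j<s with ∈-resp-↭ (insert-↭ s ys) (has (m<n⇒m<1+n j<s))
    ... | here refl = contradiction j<s (<-irrefl refl)
    ... | there j∈  = j∈
  ...   | zs , dec″ , refl = zs , dec″ , refl

  insertBelow-avoids : ∀ s {t xs} → s ≤ t → Avoids t xs → Avoids t (insertBelow s xs)
  insertBelow-avoids zero    _   a = a
  insertBelow-avoids (suc s) s<t a = insert-avoids s<t (insertBelow-avoids s (<⇒≤ s<t) a)

  insertBelow-avoids⁻ : ∀ s {t} xs → s ≤ t → Avoids t (insertBelow s xs) → Avoids t xs
  insertBelow-avoids⁻ zero    xs _   a = a
  insertBelow-avoids⁻ (suc s) xs s<t a =
    insertBelow-avoids⁻ s xs (<⇒≤ s<t) (insert-avoids⁻ (insertBelow s xs) s<t a)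

  -- The Durfee decomposition into distinct parts.

  top : List ℕ → ℕ
  top []      = 0
  top (x ∷ _) = x

  -- The Durfee decomposition at s = 0, read from the outside: m zeros, a first row exceeding
  -- the second by d, and then the same for the remaining rows shortened by one.  The list rs
  -- codes the distinct parts δ₁ > δ₂ > … > δₖ > δₖ₊₁ = 0 by rᵢ = δᵢ - δᵢ₊₁ - 1, so that
  -- hook rs = δ₁ and hookSum rs = δ₁ + … + δₖ.

  unpeel : List ℕ → List ℕ
  unpeel []           = []
  unpeel (c ∷ [])     = replicate (suc c) 0
  unpeel (m ∷ d ∷ rs) = suc (d + top (unpeel rs)) ∷ map suc (unpeel rs) ++ replicate m 0

  hook : List ℕ → ℕ
  hook []       = 0
  hook (r ∷ rs) = suc r + hook rs

  hookSum : List ℕ → ℕ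
  hookSum []       = 0
  hookSum (r ∷ rs) = hook (r ∷ rs) + hookSum rs

  evenLength : List ℕ → Bool
  evenLength []       = true
  evenLength (_ ∷ rs) = not (evenLength rs)

  oddSum-zeros : ∀ m → oddSum (replicate m 0) ≡ m
  oddSum-zeros zero    = refl
  oddSum-zeros (suc m) = cong suc (oddSum-zeros m)

  oddSum-map-suc : ∀ xs → oddSum (map suc xs) ≡ 2 * length xs + oddSum xs
  oddSum-map-suc []       = refl
  oddSum-map-suc (x ∷ xs) = trans (cong (oddPart (suc x) +_) (oddSum-map-suc xs))
    (solve 3 (λ x l o → con 1 :+ con 2 :* (con 1 :+ x) :+ (con 2 :* l :+ o)
                     := con 2 :* (con 1 :+ l) :+ (con 1 :+ con 2 :* x :+ o))
             refl x (length xs) (oddSum xs))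

  -- A first row of x + 1 boxes above k - 1 other rows has a corner hook of x + k boxes; this is δ₁.
  unpeel-hook : ∀ rs → top (unpeel rs) + length (unpeel rs) ≡ hook rs
  unpeel-hook [] = refl
  unpeel-hook (c ∷ []) = trans (cong suc (length-replicate c)) (sym (+-identityʳ (suc c)))
  unpeel-hook (m ∷ d ∷ rs) = begin
    suc (d + top xs) + suc (length (map suc xs ++ replicate m 0))
      ≡⟨ cong (λ l → suc (d + top xs) + suc l)
           (trans (length-++ (map suc xs)) (cong₂ _+_ (length-map suc xs) (length-replicate m))) ⟩
    suc (d + top xs) + suc (length xs + m)
      ≡⟨ solve 4 (λ d t l m → con 1 :+ (d :+ t) :+ (con 1 :+ (l :+ m))
                           := con 1 :+ m :+ (con 1 :+ d :+ (t :+ l)))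
           refl d (top xs) (length xs) m ⟩
    suc m + (suc d + (top xs + length xs))
      ≡⟨ cong (λ h → suc m + (suc d + h)) (unpeel-hook rs) ⟩
    hook (m ∷ d ∷ rs) ∎
    where
    open ≡-Reasoning
    xs = unpeel rs

  -- The outer layer accounts for δ₁ + δ₂: with t + l = δ₃ from `unpeel-hook`, the first row, the 2
  -- added to each of the l inner rows and the m ones give 3 + 2d + 2(t + l) + m.
  unpeel-oddSum : ∀ rs → oddSum (unpeel rs) ≡ hookSum rs
  unpeel-oddSum [] = refl
  unpeel-oddSum (c ∷ []) = trans (oddSum-zeros (suc c)) (cong suc (trans (sym (+-identityʳ c)) (sym (+-identityʳ (c + 0)))))
  unpeel-oddSum (m ∷ d ∷ rs) = begin
    oddPart (suc (d + top xs)) + oddSum (map suc xs ++ replicate m 0)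
      ≡⟨ cong (oddPart (suc (d + top xs)) +_) (trans (oddSum-++ (map suc xs) (replicate m 0))
           (cong₂ _+_ (oddSum-map-suc xs) (oddSum-zeros m))) ⟩
    oddPart (suc (d + top xs)) + (2 * length xs + oddSum xs + m)
      ≡⟨ solve 5 (λ d t l o m → con 1 :+ con 2 :* (con 1 :+ (d :+ t)) :+ (con 2 :* l :+ o :+ m)
                             := con 1 :+ m :+ (con 1 :+ d :+ (t :+ l)) :+ (con 1 :+ d :+ (t :+ l) :+ o))
           refl d (top xs) (length xs) (oddSum xs) m ⟩
    suc m + (suc d + (top xs + length xs)) + (suc d + (top xs + length xs) + oddSum xs)
      ≡⟨ cong₂ (λ h o → suc m + (suc d + h) + (suc d + h + o)) (unpeel-hook rs) (unpeel-oddSum rs) ⟩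
    hookSum (m ∷ d ∷ rs) ∎
    where
    open ≡-Reasoning
    xs = unpeel rs

  decreasing-top : ∀ {xs} → Decreasing xs → All (_≤ top xs) xs
  decreasing-top []        = []
  decreasing-top (x≥ ∷ _) = ≤-refl ∷ x≥

  zeros-decreasing : ∀ m → Decreasing (replicate m 0)
  zeros-decreasing zero    = []
  zeros-decreasing (suc m) = Allₚ.replicate⁺ m ≤-refl ∷ zeros-decreasing m

  unpeel-decreasing : ∀ rs → Decreasing (unpeel rs)
  unpeel-decreasing [] = []
  unpeel-decreasing (c ∷ []) = zeros-decreasing (suc c)
  unpeel-decreasing (m ∷ d ∷ rs) =
    Allₚ.++⁺ (Allₚ.map⁺ (All.map (λ x≤ → s≤s (≤-trans x≤ (m≤n+m _ d))) (decreasing-top dec)))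
             (Allₚ.replicate⁺ m z≤n)
    ∷ AllPairsₚ.++⁺ (AllPairsₚ.map⁺ (AllPairs.map s≤s dec)) (zeros-decreasing m)
        (Allₚ.map⁺ (All.universal (λ _ → Allₚ.replicate⁺ m z≤n) (unpeel rs)))
    where dec = unpeel-decreasing rs

  -- Past the first row the threshold is one higher, and raising every entry by 1 compensates. The
  -- trailing zeros come into play only where `xs` has run out, and there they lie below the
  -- threshold.
  avoids-shift : ∀ {s xs} m → Avoids s xs → Avoids (suc s) (map suc xs ++ replicate m 0)
  avoids-shift zero    end           = end
  avoids-shift (suc m) end           = below (s≤s z≤n)
  avoids-shift m       (below x<s)   = below (s≤s x<s)
  avoids-shift m       (above s<x a) = above (s≤s s<x) (avoids-shift m a)

  meets-shift : ∀ {s xs zs} → Meets s xs → Meets (suc s) (map suc xs ++ zs)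
  meets-shift now           = now
  meets-shift (later s<x m) = later (s≤s s<x) (meets-shift m)

  -- Every two codes add a row passed with `above`, so the outcome rests on what is left at the
  -- centre: the empty list avoids 0, a block of zeros meets it.
  unpeel-avoids : ∀ rs → T (evenLength rs) → Avoids 0 (unpeel rs)
  unpeel-avoids [] _ = end
  unpeel-avoids (m ∷ d ∷ rs) e =
    above (s≤s z≤n) (avoids-shift m (unpeel-avoids rs (subst T (not-involutive (evenLength rs)) e)))

  unpeel-meets : ∀ rs → T (not (evenLength rs)) → Meets 0 (unpeel rs)
  unpeel-meets (c ∷ []) _ = now
  unpeel-meets (m ∷ d ∷ rs) e =
    later (s≤s z≤n) (meets-shift (unpeel-meets rs (subst (T ∘ not) (not-involutive (evenLength rs)) e)))

  map-suc-zeros-injective : ∀ xs ys {m n} → map suc xs ++ replicate m 0 ≡ map suc ys ++ replicate n 0 →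
    xs ≡ ys × m ≡ n
  map-suc-zeros-injective [] [] {m} {n} e =
    refl , trans (sym (length-replicate m)) (trans (cong length e) (length-replicate n))
  map-suc-zeros-injective [] (y ∷ ys) {zero} ()
  map-suc-zeros-injective [] (y ∷ ys) {suc m} ()
  map-suc-zeros-injective (x ∷ xs) [] {n = zero} ()
  map-suc-zeros-injective (x ∷ xs) [] {n = suc n} ()
  map-suc-zeros-injective (x ∷ xs) (y ∷ ys) e with ∷-injective e
  ... | e₁ , e₂ with suc-injective e₁ | map-suc-zeros-injective xs ys e₂
  ... | refl | refl , m≡n = refl , m≡n

  unpeel-injective : ∀ rs qs → unpeel rs ≡ unpeel qs → rs ≡ qs
  unpeel-injective [] [] _ = refl
  unpeel-injective [] (c ∷ []) ()
  unpeel-injective [] (n ∷ e ∷ qs) ()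
  unpeel-injective (c ∷ []) [] ()
  unpeel-injective (c ∷ []) (c′ ∷ []) e =
    cong (_∷ []) (trans (sym (length-replicate c)) (trans (suc-injective (cong length e)) (length-replicate c′)))
  unpeel-injective (c ∷ []) (n ∷ e ∷ qs) ()
  unpeel-injective (m ∷ d ∷ rs) [] ()
  unpeel-injective (m ∷ d ∷ rs) (c ∷ []) ()
  unpeel-injective (m ∷ d ∷ rs) (n ∷ e ∷ qs) eq with ∷-injective eq
  ... | eq₁ , eq₂ with map-suc-zeros-injective (unpeel rs) (unpeel qs) eq₂
  ... | eq₃ , refl with unpeel-injective rs qs eq₃
  ... | refl = cong (λ z → m ∷ z ∷ rs) (+-cancelʳ-≡ (top (unpeel rs)) d e (suc-injective eq₁))

  all-zeros : ∀ {xs} → All (_≤ 0) xs → xs ≡ replicate (length xs) 0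
  all-zeros []         = refl
  all-zeros (z≤n ∷ zs) = cong (0 ∷_) (all-zeros zs)

  split-zeros : ∀ {xs} → Decreasing xs →
    ∃ λ ys → ∃ λ m → Decreasing ys × map suc ys ++ replicate m 0 ≡ xs
  split-zeros [] = [] , 0 , [] , refl
  split-zeros {zero ∷ xs} (x≥ ∷ _) = [] , suc (length xs) , [] , cong (0 ∷_) (sym (all-zeros x≥))
  split-zeros {suc x ∷ xs} (x≥ ∷ dec) with split-zeros dec
  ... | ys , m , dec′ , refl =
    x ∷ ys , m , All.map s≤s⁻¹ (Allₚ.map⁻ (Allₚ.++⁻ˡ (map suc ys) x≥)) ∷ dec′ , refl

  unpeel-onto : ∀ {xs} → Decreasing xs → ∃ λ rs → unpeel rs ≡ xs
  unpeel-onto dec = go _ dec ≤-refl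
    where
    length-bound : ∀ ys m → length ys ≤ length (map suc ys ++ replicate m 0)
    length-bound ys m = subst (_≤ length (map suc ys ++ replicate m 0)) (length-map suc ys)
      (subst (length (map suc ys) ≤_) (sym (length-++ (map suc ys))) (m≤m+n _ _))

    top-bound : ∀ {x} ys zs → All (_≤ suc x) (map suc ys ++ zs) → top ys ≤ x
    top-bound []       zs _       = z≤n
    top-bound (y ∷ ys) zs (b ∷ _) = s≤s⁻¹ b

    -- The inner rows are not a subterm of the list, so the recursion runs on a bound `n` for its
    -- length.
    go : ∀ n {xs} → Decreasing xs → length xs ≤ n → ∃ λ rs → unpeel rs ≡ xs
    go n [] _ = [] , refl
    go n {zero ∷ xs} (x≥ ∷ _) _ = length xs ∷ [] , cong (0 ∷_) (sym (all-zeros x≥))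
    go (suc n) {suc x ∷ xs} (x≥ ∷ dec) (s≤s len) with split-zeros dec
    ... | ys , m , dec′ , refl with go n dec′ (≤-trans (length-bound ys m) len)
    -- The code d is what x has over the first inner row; sortedness makes `∸` exact, and the
    -- default `top [] = 0` covers the case without inner rows.
    ... | rs , refl = m ∷ x ∸ top (unpeel rs) ∷ rs ,
      cong (λ z → suc z ∷ _) (m∸n+n≡m (top-bound (unpeel rs) (replicate m 0) x≥))

  -- Merging ordered lists.

  module Merging {X : Set} {_≻_ : X → X → Set} (_≻?_ : Decidable _≻_) where

    -- Comparability is asked only across the two lists, since the intended order leaves two
    -- overlined copies of one size incomparable.
    merge-ordered : Transitive _≻_ → {P Q : X → Set} → (∀ {x y} → P x → Q y → x ≻ y ⊎ y ≻ x) →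
      ∀ {xs ys} → All P xs → All Q ys → AllPairs _≻_ xs → AllPairs _≻_ ys → AllPairs _≻_ (merge _≻?_ xs ys)
    merge-ordered ≻-trans tot {[]} _ _ _ oys = oys
    merge-ordered ≻-trans tot {x ∷ xs} {[]} _ _ oxs _ = oxs
    merge-ordered ≻-trans tot {x ∷ xs} {y ∷ ys} (p ∷ ps) (q ∷ qs) (x≻ ∷ oxs) (y≻ ∷ oys)
      with x ≻? y | merge-ordered ≻-trans tot ps (q ∷ qs) oxs (y≻ ∷ oys)
                  | merge-ordered ≻-trans tot (p ∷ ps) qs (x≻ ∷ oxs) oys
    ... | yes x≻y | rec | _ =
      All-resp-↭ (↭-sym (merge-↭ _≻?_ xs (y ∷ ys))) (Allₚ.++⁺ x≻ (x≻y ∷ All.map (≻-trans x≻y) y≻)) ∷ rec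
    ... | no x⊁y | _ | rec with tot p q
    ...   | inj₁ x≻y = contradiction x≻y x⊁y
    ...   | inj₂ y≻x =
      All-resp-↭ (↭-sym (merge-↭ _≻?_ (x ∷ xs) ys)) (Allₚ.++⁺ (y≻x ∷ All.map (≻-trans y≻x) x≻) y≻) ∷ rec

    filter-mergeˡ : {P : X → Set} (P? : U.Decidable P) → ∀ {xs ys} → All P xs → All (¬_ ∘ P) ys →
      filter P? (merge _≻?_ xs ys) ≡ xs
    filter-mergeˡ P? {[]} _ ¬qs = filter-none P? ¬qs
    filter-mergeˡ P? {x ∷ xs} {[]} ps _ = filter-all P? ps
    filter-mergeˡ P? {x ∷ xs} {y ∷ ys} (p ∷ ps) (¬q ∷ ¬qs)
      with x ≻? y | filter-mergeˡ P? ps (¬q ∷ ¬qs) | filter-mergeˡ P? (p ∷ ps) ¬qs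
    ... | yes _ | rec | _ = trans (filter-accept P? p) (cong (x ∷_) rec)
    ... | no _  | _ | rec = trans (filter-reject P? ¬q) rec

    filter-mergeʳ : {P : X → Set} (P? : U.Decidable P) → ∀ {xs ys} → All (¬_ ∘ P) xs → All P ys →
      filter P? (merge _≻?_ xs ys) ≡ ys
    filter-mergeʳ P? {[]} _ qs = filter-all P? qs
    filter-mergeʳ P? {x ∷ xs} {[]} ¬ps _ = filter-none P? ¬ps
    filter-mergeʳ P? {x ∷ xs} {y ∷ ys} (¬p ∷ ¬ps) (q ∷ qs)
      with x ≻? y | filter-mergeʳ P? ¬ps (q ∷ qs) | filter-mergeʳ P? (¬p ∷ ¬ps) qs
    ... | yes _ | rec | _ = trans (filter-reject P? ¬p) rec
    ... | no _  | _ | rec = trans (filter-accept P? q) (cong (y ∷_) rec)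

    merge-headˡ : ∀ {x} xs {ys} → All (x ≻_) ys → merge _≻?_ (x ∷ xs) ys ≡ x ∷ merge _≻?_ xs ys
    merge-headˡ []       [] = refl
    merge-headˡ (_ ∷ _)  [] = refl
    merge-headˡ {x} xs {y ∷ ys} (x≻y ∷ _) with x ≻? y
    ... | yes _  = refl
    ... | no x⊁y = contradiction x≻y x⊁y

    merge-headʳ : ∀ {y xs} ys → All (λ x → ¬ (x ≻ y)) xs → merge _≻?_ xs (y ∷ ys) ≡ y ∷ merge _≻?_ xs ys
    merge-headʳ ys [] = refl
    merge-headʳ {y} {x ∷ xs} ys (x⊁y ∷ _) with x ≻? y
    ... | yes x≻y = contradiction x≻y x⊁y
    ... | no _    = refl

    -- `merge` takes from the left list whenever it can, so a right element x comes out first only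
    -- if no remaining left y has y ≻ x. By antisymmetry such a y would equal x, but `P` holds for y
    -- alone.
    merge-filter : (∀ {x y} → x ≻ y → y ≻ x → x ≡ y) →
      {P Q : X → Set} (P? : U.Decidable P) (Q? : U.Decidable Q) →
      (∀ {x} → P x → ¬ Q x) → (∀ {x} → ¬ P x → Q x) →
      ∀ {xs} → AllPairs _≻_ xs → merge _≻?_ (filter P? xs) (filter Q? xs) ≡ xs
    merge-filter antisym P? Q? P⇒¬Q ¬P⇒Q [] = refl
    merge-filter antisym {P} P? Q? P⇒¬Q ¬P⇒Q {x ∷ xs} (x≻ ∷ oxs) with P? x
    ... | yes p rewrite filter-reject Q? {xs = xs} (P⇒¬Q p) =
      trans (merge-headˡ (filter P? xs) (Allₚ.filter⁺ Q? x≻)) (cong (x ∷_) (merge-filter antisym P? Q? P⇒¬Q ¬P⇒Q oxs))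
    ... | no ¬p rewrite filter-accept Q? {xs = xs} (¬P⇒Q ¬p) =
      trans (merge-headʳ (filter Q? xs) (All.zipWith x⊁ (Allₚ.filter⁺ P? x≻ , Allₚ.all-filter P? xs)))
        (cong (x ∷_) (merge-filter antisym P? Q? P⇒¬Q ¬P⇒Q oxs))
      where
      x⊁ : ∀ {y} → (x ≻ y) × P y → ¬ (y ≻ x)
      x⊁ (x≻y , py) y≻x = ¬p (subst P (antisym y≻x x≻y) py)

  -- Overpartitions as lists ordered by `_≻_`.

  infix 4 _≻_ _≻?_

  -- Being transitive, this relation expresses the adjacent condition of `ordOP` pairwise. It is
  -- reflexive exactly at non-overlined parts, so only these may repeat.
  data _≻_ : ℕ × Bool → ℕ × Bool → Set where
    larger  : ∀ {m n b c} → n < m → (m , b) ≻ (n , c)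
    repeats : ∀ {m b} → (m , b) ≻ (m , false)

  _≻?_ : Decidable _≻_
  (m , b) ≻? (n , c) with <-cmp n m
  ... | tri< n<m _ _ = yes (larger n<m)
  ... | tri> n≮m n≢m _ = no λ { (larger n<m) → n≮m n<m ; repeats → n≢m refl }
  (m , b) ≻? (.m , false) | tri≈ _ refl _ = yes repeats
  (m , b) ≻? (.m , true)  | tri≈ n≮m refl _ = no λ { (larger n<m) → n≮m n<m }

  ≻-trans : Transitive _≻_
  ≻-trans (larger p) (larger q) = larger (<-trans q p)
  ≻-trans (larger p) repeats    = larger p
  ≻-trans repeats    (larger q) = larger q
  ≻-trans repeats    repeats    = repeats

  ≻-antisym : ∀ {x y} → x ≻ y → y ≻ x → x ≡ y
  ≻-antisym (larger p) (larger q) = contradiction q (<-asym p)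
  ≻-antisym (larger p) repeats    = contradiction p (<-irrefl refl)
  ≻-antisym repeats    (larger q) = contradiction q (<-irrefl refl)
  ≻-antisym repeats    repeats    = refl

  -- In each merge used below the right list is free of overlined parts, which meets this
  -- hypothesis.
  ≻-total : ∀ {x y} → ¬ (T (proj₂ x) × T (proj₂ y)) → x ≻ y ⊎ y ≻ x
  ≻-total {m , b} {n , c} ¬both with <-cmp n m
  ≻-total {m , b} {n , c} ¬both | tri< n<m _ _ = inj₁ (larger n<m)
  ≻-total {m , b} {n , c} ¬both | tri> _ _ m<n = inj₂ (larger m<n)
  ≻-total {m , b} {.m , false} ¬both | tri≈ _ refl _ = inj₁ repeats
  ≻-total {m , false} {.m , true} ¬both | tri≈ _ refl _ = inj₂ repeats
  ≻-total {m , true} {.m , true} ¬both | tri≈ _ refl _ = contradiction (tt , tt) ¬both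

  ≥⇒≻ : ∀ {m n b} → m ≥ n → (m , b) ≻ (n , false)
  ≥⇒≻ m≥n with m≤n⇒m<n∨m≡n m≥n
  ... | inj₁ n<m  = larger n<m
  ... | inj₂ refl = repeats

  ≻⇒≥ : ∀ {m n b c} → (m , b) ≻ (n , c) → m ≥ n
  ≻⇒≥ (larger n<m) = <⇒≤ n<m
  ≻⇒≥ repeats      = ≤-refl

  open Merging _≻?_

  ≻-fromBool : ∀ {p q} → T ((proj₁ q <ᵇ proj₁ p) ∨ ((proj₁ q ≡ᵇ proj₁ p) ∧ not (proj₂ q))) → p ≻ q
  ≻-fromBool {m , b} {n , c} t with Equivalence.to (T-∨ {n <ᵇ m}) t
  ... | inj₁ lt = larger (<ᵇ⇒< n m lt)
  ... | inj₂ e with Equivalence.to (T-∧ {n ≡ᵇ m}) e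
  ≻-fromBool {m , b} {n , false} t | inj₂ e | n≡m , _ with ≡ᵇ⇒≡ n m n≡m
  ... | refl = repeats

  ≻-toBool : ∀ {p q} → p ≻ q → T ((proj₁ q <ᵇ proj₁ p) ∨ ((proj₁ q ≡ᵇ proj₁ p) ∧ not (proj₂ q)))
  ≻-toBool (larger n<m) = Equivalence.from T-∨ (inj₁ (<⇒<ᵇ n<m))
  ≻-toBool (repeats {m}) = Equivalence.from (T-∨ {m <ᵇ m}) (inj₂ (Equivalence.from T-∧ (≡⇒≡ᵇ m m refl , tt)))

  ordOP⇒linked : ∀ π → T (ordOP π) → Linked _≻_ π
  ordOP⇒linked []          _ = []
  ordOP⇒linked (p ∷ [])    _ = [-]
  ordOP⇒linked (p ∷ q ∷ π) t =
    let pq , t′ = Equivalence.to T-∧ t in ≻-fromBool pq ∷ ordOP⇒linked (q ∷ π) t′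

  linked⇒ordOP : ∀ {π} → Linked _≻_ π → T (ordOP π)
  linked⇒ordOP []       = tt
  linked⇒ordOP [-]      = tt
  linked⇒ordOP (pq ∷ l) = Equivalence.from T-∧ (≻-toBool pq , linked⇒ordOP l)

  Overpartition : ℕ → List (ℕ × Bool) → Set
  Overpartition n π = All Positive π × AllPairs _≻_ π × size π ≡ n

  isOverpartition⇒ : ∀ {n} π → T (isOverpartition n π) → Overpartition n π
  isOverpartition⇒ {n} π t with Equivalence.to T-∧ t
  ... | pos , t′ with Equivalence.to (T-∧ {ordOP π}) t′
  ... | ord , sz = All.map (λ {p} → ≤ᵇ⇒≤ 1 (proj₁ p)) (Allₚ.all⁺ _ π pos)
                 , Linked⇒AllPairs ≻-trans (ordOP⇒linked π ord) , ≡ᵇ⇒≡ _ n sz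

  ⇒isOverpartition : ∀ {n} π → Overpartition n π → T (isOverpartition n π)
  ⇒isOverpartition {n} π (pos , ord , sz) = Equivalence.from T-∧
    ( Allₚ.all⁻ (λ x → 1 ≤ᵇ proj₁ x) (All.map ≤⇒≤ᵇ pos)
    , Equivalence.from T-∧ (linked⇒ordOP (AllPairs⇒Linked ord) , ≡⇒≡ᵇ _ n sz))

  size-merge : ∀ xs ys → size (merge _≻?_ xs ys) ≡ size xs + size ys
  size-merge xs ys = trans (sum-↭ (map⁺ proj₁ (merge-↭ _≻?_ xs ys)))
    (trans (cong sum (map-++ proj₁ xs ys)) (sum-++ (map proj₁ xs) (map proj₁ ys)))

  T-not⇒¬T : ∀ {b} → T (not b) → ¬ T b
  T-not⇒¬T {false} _ ()

  ¬T⇒T-not : ∀ {b} → ¬ T b → T (not b)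
  ¬T⇒T-not {false} _ = tt
  ¬T⇒T-not {true}  f = contradiction tt f

  -- Splitting off the non-overlined odd parts.

  image : {X Y : Set} {P : X → Set} {f : Y → X} → (∀ {x} → P x → ∃ λ y → f y ≡ x) →
    ∀ {xs} → All P xs → ∃ λ ys → map f ys ≡ xs
  image inv [] = [] , refl
  image inv (p ∷ ps) with inv p | image inv ps
  ... | y , refl | ys , refl = y ∷ ys , refl

  plainOdd : ℕ → ℕ × Bool
  plainOdd x = oddPart x , false

  oddPart-isOdd : ∀ x → oddPart x % 2 ≡ 1
  oddPart-isOdd x = trans (cong (λ z → (1 + z) % 2) (*-comm 2 x)) ([m+kn]%n≡m%n 1 x 2)

  half-double : ∀ x → (2 * x) / 2 ≡ x
  half-double x = trans (cong (_/ 2) (*-comm 2 x)) (m*n/n≡m x 2)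

  plainOdd-nonOvOdd : ∀ x → T (nonOvOdd (plainOdd x))
  plainOdd-nonOvOdd x = ≡⇒≡ᵇ _ 1 (oddPart-isOdd x)

  oddPart-injective : ∀ {x y} → oddPart x ≡ oddPart y → x ≡ y
  oddPart-injective e = *-cancelˡ-≡ _ _ 2 (suc-injective e)

  plainOdd-injective : ∀ {x y} → plainOdd x ≡ plainOdd y → x ≡ y
  plainOdd-injective e = oddPart-injective (cong proj₁ e)

  plainOdd-image : ∀ {p} → T (nonOvOdd p) → ∃ λ x → plainOdd x ≡ p
  plainOdd-image {n , false} t = n / 2 , cong (_, false)
    (sym (trans (m≡m%n+[m/n]*n n 2) (cong₂ _+_ (≡ᵇ⇒≡ (n % 2) 1 t) (*-comm (n / 2) 2))))

  plainOdd-mono : ∀ {x y} → x ≥ y → plainOdd x ≻ plainOdd y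
  plainOdd-mono x≥y = ≥⇒≻ (s≤s (*-monoʳ-≤ 2 x≥y))

  plainOdd-mono⁻ : ∀ {x y} → plainOdd x ≻ plainOdd y → x ≥ y
  plainOdd-mono⁻ p = *-cancelˡ-≤ 2 (s≤s⁻¹ (≻⇒≥ p))

  Rest : List (ℕ × Bool) → Set
  Rest ρ = All Positive ρ × AllPairs _≻_ ρ × All (T ∘ not ∘ nonOvOdd) ρ

  join : List (ℕ × Bool) → List ℕ → List (ℕ × Bool)
  join ρ xs = merge _≻?_ ρ (map plainOdd xs)

  odds : List (ℕ × Bool) → List (ℕ × Bool)
  odds = filter (λ p → T? (nonOvOdd p))

  others : List (ℕ × Bool) → List (ℕ × Bool)
  others = filter (λ p → T? (not (nonOvOdd p)))

  map-plainOdd-odd : ∀ xs → All (T ∘ nonOvOdd) (map plainOdd xs)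
  map-plainOdd-odd xs = Allₚ.map⁺ (All.universal plainOdd-nonOvOdd xs)

  odds-join : ∀ {ρ} xs → Rest ρ → odds (join ρ xs) ≡ map plainOdd xs
  odds-join xs (_ , _ , ¬odd) =
    filter-mergeʳ (λ p → T? (nonOvOdd p)) (All.map T-not⇒¬T ¬odd) (map-plainOdd-odd xs)

  others-join : ∀ {ρ} xs → Rest ρ → others (join ρ xs) ≡ ρ
  others-join xs (_ , _ , ¬odd) =
    filter-mergeˡ (λ p → T? (not (nonOvOdd p))) ¬odd (All.map (λ t f → T-not⇒¬T f t) (map-plainOdd-odd xs))

  size-plainOdd : ∀ xs → size (map plainOdd xs) ≡ oddSum xs
  size-plainOdd xs = cong sum (sym (map-∘ xs))

  size-join : ∀ ρ xs → size (join ρ xs) ≡ size ρ + oddSum xs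
  size-join ρ xs = trans (size-merge ρ (map plainOdd xs)) (cong (size ρ +_) (size-plainOdd xs))

  join-overpartition : ∀ {ρ xs} → Rest ρ → Decreasing xs → Overpartition (size ρ + oddSum xs) (join ρ xs)
  join-overpartition {ρ} {xs} (pos , ord , ¬odd) dec =
      All-resp-↭ (↭-sym (merge-↭ _≻?_ ρ (map plainOdd xs)))
        (Allₚ.++⁺ pos (Allₚ.map⁺ (All.universal (λ _ → s≤s z≤n) xs)))
    , merge-ordered ≻-trans (λ { {y = n , false} _ _ → ≻-total λ () ; {y = n , true} _ () }) ¬odd (map-plainOdd-odd xs)
        ord (AllPairsₚ.map⁺ (AllPairs.map plainOdd-mono dec))
    , size-join ρ xs

  join-onto : ∀ {n π} → Overpartition n π →
    ∃ λ ρ → ∃ λ xs → Rest ρ × Decreasing xs × join ρ xs ≡ π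
  join-onto {π = π} (pos , ord , _) with image plainOdd-image (Allₚ.all-filter (λ p → T? (nonOvOdd p)) π)
  ... | xs , e = others π , xs
    , (Allₚ.filter⁺ _ pos , AllPairsₚ.filter⁺ _ ord , Allₚ.all-filter _ π)
    , AllPairs.map plainOdd-mono⁻ (AllPairsₚ.map⁻ (subst (AllPairs _≻_) (sym e) (AllPairsₚ.filter⁺ _ ord)))
    , trans (cong (merge _≻?_ (others π)) e)
        (merge-filter ≻-antisym (λ p → T? (not (nonOvOdd p))) (λ p → T? (nonOvOdd p)) T-not⇒¬T (λ {p} → dne {p}) ord)
    where
    dne : ∀ {p} → ¬ T (not (nonOvOdd p)) → T (nonOvOdd p)
    dne {p} f with nonOvOdd p
    ... | true  = tt
    ... | false = contradiction tt f

  -- The remaining parts: overlined, and even non-overlined.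

  overlined : ℕ → ℕ × Bool
  overlined a = a , true

  plainEven : ℕ → ℕ × Bool
  plainEven b = 2 * b , false

  StrictlyDecreasing : List ℕ → Set
  StrictlyDecreasing = AllPairs _>_

  rest : List ℕ → List ℕ → List (ℕ × Bool)
  rest as bs = merge _≻?_ (map overlined as) (map plainEven bs)

  even-not-odd : ∀ b → T (not (isOdd (2 * b)))
  even-not-odd b rewrite trans (cong (_% 2) (*-comm 2 b)) (m*n%n≡0 b 2) = tt

  rest-ok : ∀ {as bs} → All (1 ≤_) as → All (1 ≤_) bs → StrictlyDecreasing as → Decreasing bs → Rest (rest as bs)
  rest-ok {as} {bs} pa pb da db =
      resp (Allₚ.++⁺ (Allₚ.map⁺ pa) (Allₚ.map⁺ (All.map (λ 1≤b → ≤-trans 1≤b (m≤m+n _ _)) pb)))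
    , merge-ordered ≻-trans {P = λ _ → ⊤} {Q = T ∘ not ∘ proj₂}
        (λ _ q → ≻-total λ (_ , t) → T-not⇒¬T q t)
        (All.universal (λ _ → tt) (map overlined as)) (Allₚ.map⁺ (All.universal (λ _ → tt) bs))
        (AllPairsₚ.map⁺ (AllPairs.map larger da)) (AllPairsₚ.map⁺ (AllPairs.map (λ x≥y → ≥⇒≻ (*-monoʳ-≤ 2 x≥y)) db))
    , resp (Allₚ.++⁺ (Allₚ.map⁺ (All.universal (λ _ → tt) as)) (Allₚ.map⁺ (All.universal even-not-odd bs)))
    where
    resp : ∀ {P : ℕ × Bool → Set} → All P (map overlined as ++ map plainEven bs) → All P (rest as bs)
    resp = All-resp-↭ (↭-sym (merge-↭ _≻?_ (map overlined as) (map plainEven bs)))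

  sum-double : ∀ bs → size (map plainEven bs) ≡ 2 * sum bs
  sum-double [] = refl
  sum-double (b ∷ bs) = trans (cong (2 * b +_) (sum-double bs)) (sym (*-distribˡ-+ 2 b (sum bs)))

  size-rest : ∀ as bs → size (rest as bs) ≡ sum as + 2 * sum bs
  size-rest as bs = trans (size-merge (map overlined as) (map plainEven bs))
    (cong₂ _+_ (cong sum (trans (sym (map-∘ as)) (map-id as))) (sum-double bs))

  rest-injective : ∀ {as bs cs ds} → rest as bs ≡ rest cs ds → as ≡ cs × bs ≡ ds
  rest-injective {as} {bs} {cs} {ds} e =
      map-injective (cong proj₁) (trans (sym (left as bs)) (trans (cong (filter _) e) (left cs ds)))
    , map-injective (*-cancelˡ-≡ _ _ 2 ∘ cong proj₁) (trans (sym (right as bs)) (trans (cong (filter _) e) (right cs ds)))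
    where
    left : ∀ as bs → filter (λ p → T? (proj₂ p)) (rest as bs) ≡ map overlined as
    left as bs = filter-mergeˡ _ (Allₚ.map⁺ (All.universal (λ _ → tt) as)) (Allₚ.map⁺ (All.universal (λ _ ()) bs))

    right : ∀ as bs → filter (λ p → T? (not (proj₂ p))) (rest as bs) ≡ map plainEven bs
    right as bs = filter-mergeʳ _ (Allₚ.map⁺ (All.universal (λ _ ()) as)) (Allₚ.map⁺ (All.universal (λ _ → tt) bs))

  rest-onto : ∀ {ρ} → Rest ρ → ∃ λ as → ∃ λ bs →
    All (1 ≤_) as × All (1 ≤_) bs × StrictlyDecreasing as × Decreasing bs × rest as bs ≡ ρ
  rest-onto {ρ} (pos , ord , ¬odd)
    with image {f = overlined} ov (Allₚ.all-filter (λ p → T? (proj₂ p)) ρ)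
       | image {f = plainEven} ev (All.zip (Allₚ.all-filter (λ p → T? (not (proj₂ p))) ρ , Allₚ.filter⁺ _ ¬odd))
    where
    ov : ∀ {p : ℕ × Bool} → T (proj₂ p) → ∃ λ a → overlined a ≡ p
    ov {n , true} _ = n , refl

    %2-cases : ∀ n → T (not (isOdd n)) → n % 2 ≡ 0
    %2-cases n t with n % 2 | m%n<n n 2
    ... | 0 | _ = refl
    ... | suc (suc _) | s≤s (s≤s ())

    ev : ∀ {p : ℕ × Bool} → T (not (proj₂ p)) × T (not (nonOvOdd p)) → ∃ λ b → plainEven b ≡ p
    ev {n , false} (_ , t) = n / 2 , cong (_, false)
      (sym (trans (m≡m%n+[m/n]*n n 2) (cong₂ _+_ (%2-cases n t) (*-comm (n / 2) 2))))
  ... | as , ea | bs , eb = as , bs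
    , Allₚ.map⁻ (subst (All Positive) (sym ea) (Allₚ.filter⁺ _ pos))
    , All.map halve (Allₚ.map⁻ (subst (All Positive) (sym eb) (Allₚ.filter⁺ _ pos)))
    , AllPairs.map strict (AllPairsₚ.map⁻ (subst (AllPairs _≻_) (sym ea) (AllPairsₚ.filter⁺ _ ord)))
    , AllPairs.map (*-cancelˡ-≤ 2 ∘ ≻⇒≥) (AllPairsₚ.map⁻ (subst (AllPairs _≻_) (sym eb) (AllPairsₚ.filter⁺ _ ord)))
    , trans (cong₂ (merge _≻?_) ea eb)
        (merge-filter ≻-antisym (λ p → T? (proj₂ p)) (λ p → T? (not (proj₂ p))) (λ t f → T-not⇒¬T f t) ¬T⇒T-not ord)
    where
    halve : ∀ {b} → 1 ≤ 2 * b → 1 ≤ b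
    halve {suc b} _ = s≤s z≤n

    strict : ∀ {x y} → overlined x ≻ overlined y → x > y
    strict (larger y<x) = y<x

  -- Splitting a partition into distinct parts and pairs of equal parts.

  -- The last binary digit of each multiplicity goes to as, the rest of it to bs: this is
  -- (1 + qⁱ)/(1 - q²ⁱ) = 1/(1 - qⁱ).

  data Split : List ℕ → List ℕ → List ℕ → Set where
    none   : Split [] [] []
    double : ∀ {x μ as bs} → All (_≤ x) μ → Split μ as bs → Split (x ∷ x ∷ μ) as (x ∷ bs)
    single : ∀ {x μ as bs} → All (_< x) μ → Split μ as bs → Split (x ∷ μ) (x ∷ as) bs

  split-all : ∀ {P : ℕ → Set} {μ as bs} → Split μ as bs → All P μ → All P as × All P bs
  split-all none           []           = [] , []
  split-all (double _ sp) (p ∷ _ ∷ ps) = let pa , pb = split-all sp ps in pa , p ∷ pb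
  split-all (single _ sp) (p ∷ ps)     = let pa , pb = split-all sp ps in p ∷ pa , pb

  split-all⁻ : ∀ {P : ℕ → Set} {μ as bs} → Split μ as bs → All P as → All P bs → All P μ
  split-all⁻ none          _        _        = []
  split-all⁻ (double _ sp) pa       (p ∷ pb) = p ∷ p ∷ split-all⁻ sp pa pb
  split-all⁻ (single _ sp) (p ∷ pa) pb       = p ∷ split-all⁻ sp pa pb

  split-strict : ∀ {μ as bs} → Split μ as bs → StrictlyDecreasing as
  split-strict none           = []
  split-strict (double _ sp)  = split-strict sp
  split-strict (single b sp)  = proj₁ (split-all sp b) ∷ split-strict sp

  split-decreasing : ∀ {μ as bs} → Split μ as bs → Decreasing bs
  split-decreasing none          = []
  split-decreasing (double b sp) = proj₂ (split-all sp b) ∷ split-decreasing sp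
  split-decreasing (single _ sp) = split-decreasing sp

  split-decreasing⁻ : ∀ {μ as bs} → Split μ as bs → Decreasing μ
  split-decreasing⁻ none          = []
  split-decreasing⁻ (double b sp) = (≤-refl ∷ b) ∷ b ∷ split-decreasing⁻ sp
  split-decreasing⁻ (single b sp) = All.map <⇒≤ b ∷ split-decreasing⁻ sp

  split-sum : ∀ {μ as bs} → Split μ as bs → sum μ ≡ sum as + 2 * sum bs
  split-sum none = refl
  split-sum (double {x} {as = as} {bs} _ sp) = trans (cong (λ z → x + (x + z)) (split-sum sp))
    (solve 3 (λ x a b → x :+ (x :+ (a :+ con 2 :* b)) := a :+ con 2 :* (x :+ b)) refl x (sum as) (sum bs))
  split-sum (single {x} {as = as} _ sp) = trans (cong (x +_) (split-sum sp)) (sym (+-assoc x (sum as) _))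

  split-total : ∀ {μ} → Decreasing μ → ∃ λ as → ∃ λ bs → Split μ as bs
  split-total [] = [] , [] , none
  split-total {x ∷ []} _ = x ∷ [] , [] , single [] none
  -- A leading pair of equal entries goes to `bs` first; a lone leading entry is then strictly
  -- largest, as `single` demands.
  split-total {x ∷ y ∷ μ} ((x≥y ∷ _) ∷ y≥ ∷ dec)
    with x ≟ y | split-total dec | split-total (y≥ ∷ dec)
  ... | yes refl | as , bs , sp | _ = as , x ∷ bs , double y≥ sp
  ... | no x≢y   | _ | as , bs , sp = x ∷ as , bs , single (y<x ∷ All.map (λ z≤y → ≤-<-trans z≤y y<x) y≥) sp
    where y<x = ≤∧≢⇒< x≥y (x≢y ∘ sym)

  split-onto : ∀ {as bs} → StrictlyDecreasing as → Decreasing bs → ∃ λ μ → Split μ as bs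
  split-onto [] [] = [] , none
  split-onto {bs = b ∷ bs} [] (b≥ ∷ db) with split-onto [] db
  ... | μ , sp = b ∷ b ∷ μ , double (split-all⁻ sp [] b≥) sp
  split-onto {a ∷ as} (a> ∷ da) [] with split-onto da []
  ... | μ , sp = a ∷ μ , single (split-all⁻ sp a> []) sp
  split-onto {a ∷ as} {b ∷ bs} (a> ∷ da) (b≥ ∷ db)
    with a ≤? b | split-onto (a> ∷ da) db | split-onto da (b≥ ∷ db)
  -- On a tie the pair goes first, since `single` needs everything after it to be strictly smaller.
  ... | yes a≤b | μ , sp | _ =
    b ∷ b ∷ μ , double (split-all⁻ sp (a≤b ∷ All.map (λ z<a → ≤-trans (<⇒≤ z<a) a≤b) a>) b≥) sp
  ... | no a≰b | _ | μ , sp =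
    a ∷ μ , single (split-all⁻ sp a> (≰⇒> a≰b ∷ All.map (λ z≤b → ≤-<-trans z≤b (≰⇒> a≰b)) b≥)) sp

  split-functional : ∀ {μ as bs cs ds} → Split μ as bs → Split μ cs ds → as ≡ cs × bs ≡ ds
  split-functional none none = refl , refl
  split-functional (double _ s) (double _ t) with split-functional s t
  ... | refl , refl = refl , refl
  split-functional (double _ _) (single (x<x ∷ _) _) = contradiction x<x (<-irrefl refl)
  split-functional (single (x<x ∷ _) _) (double _ _) = contradiction x<x (<-irrefl refl)
  split-functional (single _ s) (single _ t) with split-functional s t
  ... | refl , refl = refl , refl

  split-injective : ∀ {μ μ′ as bs} → Split μ as bs → Split μ′ as bs → μ ≡ μ′
  split-injective none none = refl
  split-injective (double _ s) (double _ t) = cong (λ z → _ ∷ _ ∷ z) (split-injective s t)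
  -- `double` makes the head of `bs` at least that of `as`, while `single` makes it strictly
  -- smaller.
  split-injective (double b s) (single c t) =
    contradiction (All.head (proj₁ (split-all s b))) (<⇒≱ (All.head (proj₂ (split-all t c))))
  split-injective (single c t) (double b s) =
    contradiction (All.head (proj₁ (split-all s b))) (<⇒≱ (All.head (proj₂ (split-all t c))))
  split-injective (single _ s) (single _ t) = cong (_ ∷_) (split-injective s t)

  -- Bijections between classes of decomposed overpartitions.

  Decomposed : (List ℕ → Set) → ℕ → List (ℕ × Bool) × List ℕ → Set
  Decomposed D n (ρ , xs) = Rest ρ × Decreasing xs × D xs × size ρ + oddSum xs ≡ n

  -- The pair stands for (μ, δ), with δ coded by `rs`; `e` is `true` when δ has an even number of
  -- parts.
  Hooked : Bool → ℕ → List ℕ × List ℕ → Set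
  Hooked e n (μ , rs) = All (1 ≤_) μ × Decreasing μ × evenLength rs ≡ e × sum μ + hookSum rs ≡ n

  -- μ passes to ρ through `Split` and `rest`, δ to λ through `unpeel`; both keep sizes, so only the
  -- parity of δ has to be matched with `D`.
  Hooked≅Decomposed : ∀ {D : List ℕ → Set} {e} n → (∀ rs → evenLength rs ≡ e → D (unpeel rs)) →
    (∀ rs → D (unpeel rs) → evenLength rs ≡ e) → Hooked e n ≅ Decomposed D n
  Hooked≅Decomposed {D} {e} n D⁺ D⁻ = record
    { rel        = _~_
    ; total      = λ {z} → total {z}
    ; onto       = onto
    ; injective  = injective
    ; functional = λ {z} → functional {z}
    }
    where
    _~_ : List ℕ × List ℕ → List (ℕ × Bool) × List ℕ → Set
    (μ , rs) ~ (ρ , xs) = ∃ λ as → ∃ λ bs → Split μ as bs × rest as bs ≡ ρ × unpeel rs ≡ xs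

    sizes : ∀ {μ as bs} rs → Split μ as bs → size (rest as bs) + oddSum (unpeel rs) ≡ sum μ + hookSum rs
    sizes {as = as} {bs} rs sp =
      cong₂ _+_ (trans (size-rest as bs) (sym (split-sum sp))) (unpeel-oddSum rs)

    total : ∀ {z} → Hooked e n z → ∃ λ w → Decomposed D n w × z ~ w
    total {μ , rs} (pos , dec , ev , sz) =
      let as , bs , sp = split-total dec
          pa , pb = split-all sp pos
      in (rest as bs , unpeel rs)
       , (rest-ok pa pb (split-strict sp) (split-decreasing sp) , unpeel-decreasing rs , D⁺ rs ev , trans (sizes rs sp) sz)
       , as , bs , sp , refl , refl

    onto : ∀ {w} → Decomposed D n w → ∃ λ z → Hooked e n z × z ~ w
    onto {ρ , xs} (r , dec , d , sz) with rest-onto r | unpeel-onto dec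
    ... | as , bs , pa , pb , da , db , refl | rs , refl =
      let μ , sp = split-onto da db
      in (μ , rs)
       , (split-all⁻ sp pa pb , split-decreasing⁻ sp , D⁻ rs d , trans (sym (sizes rs sp)) sz)
       , as , bs , sp , refl , refl

    injective : ∀ {z z′ w} → z ~ w → z′ ~ w → z ≡ z′
    injective {_ , rs} {_ , rs′} (as , bs , sp , eρ , ex) (as′ , bs′ , sp′ , eρ′ , ex′)
      with rest-injective {as} {bs} {as′} {bs′} (trans eρ (sym eρ′))
    ... | refl , refl = cong₂ _,_ (split-injective sp sp′) (unpeel-injective rs rs′ (trans ex (sym ex′)))

    functional : ∀ {z w w′} → z ~ w → z ~ w′ → w ≡ w′
    functional (as , bs , sp , refl , refl) (as′ , bs′ , sp′ , refl , refl) with split-functional sp sp′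
    ... | refl , refl = refl

  -- The largest part of the distinct partition coded by r ∷ rs moves to μ.

  data Move : List ℕ × List ℕ → List ℕ × List ℕ → Set where
    move : ∀ {h μ r rs} → h ≡ hook (r ∷ rs) → All (_≤ h) μ → Move (μ , r ∷ rs) (h ∷ μ , rs)

  toggle : ∀ n → 1 ≤ n → Hooked true n ≅ Hooked false n
  toggle n 1≤n = record
    { rel        = _~_
    ; total      = partner
    ; onto       = λ k → let z , k′ , m = partner k in z , k′ , Sum.swap m
    ; injective  = λ m m′ → functional (Sum.swap m) (Sum.swap m′)
    ; functional = functional
    }
    where
    _~_ : List ℕ × List ℕ → List ℕ × List ℕ → Set
    z ~ z′ = Move z z′ ⊎ Move z′ z

    functional : ∀ {z z′ z″} → z ~ z′ → z ~ z″ → z′ ≡ z″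
    functional (inj₁ (move refl _)) (inj₁ (move refl _)) = refl
    -- Moves in both directions out of one pair would make the largest part of μ both at most and
    -- larger than that of δ.
    functional (inj₁ (move refl (b ∷ _))) (inj₂ (move refl _)) = contradiction (s≤s (m≤n+m _ _)) (<⇒≱ (s≤s b))
    functional (inj₂ (move refl _)) (inj₁ (move refl (b ∷ _))) = contradiction (s≤s (m≤n+m _ _)) (<⇒≱ (s≤s b))
    functional (inj₂ (move {rs = rs} refl _)) (inj₂ (move e _)) =
      cong (λ r → _ , r ∷ rs) (+-cancelʳ-≡ (hook rs) _ _ (suc-injective e))

    moveSum : ∀ {μ r rs} → sum μ + hookSum (r ∷ rs) ≡ hook (r ∷ rs) + sum μ + hookSum rs
    moveSum {μ} {r} {rs} = solve 3 (λ m h s → m :+ (h :+ s) := h :+ m :+ s) refl (sum μ) (hook (r ∷ rs)) (hookSum rs)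

    flip : ∀ {b e} → not b ≡ e → b ≡ not e
    flip {b} refl = sym (not-involutive b)

    takeHook : ∀ {e μ r rs} → Hooked e n (μ , r ∷ rs) → All (_≤ hook (r ∷ rs)) μ →
      ∃ λ z → Hooked (not e) n z × ((μ , r ∷ rs) ~ z)
    takeHook {μ = μ} {r} {rs} (pos , dec , ev , sz) b =
      (hook (r ∷ rs) ∷ μ , rs)
      , (s≤s z≤n ∷ pos , b ∷ dec , flip ev , trans (sym (moveSum {μ} {r} {rs})) sz) , inj₁ (move refl b)

    -- The larger of the two largest parts moves, a tie going from δ to μ; positivity of n excludes
    -- that both partitions are empty.
    partner : ∀ {e z} → Hooked e n z → ∃ λ z′ → Hooked (not e) n z′ × z ~ z′
    partner {z = [] , []} (_ , _ , _ , sz) = contradiction sz (<⇒≢ 1≤n)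
    partner {z = [] , r ∷ rs} k = takeHook k []
    partner {z = x ∷ μ , rs} (x≥1 ∷ pos , x≥ ∷ dec , ev , sz) with hook rs <? x
    partner {z = x ∷ μ , rs} (x≥1 ∷ pos , x≥ ∷ dec , ev , sz) | yes h<x =
      -- The code is chosen so that the new largest part of δ is x; x > `hook rs` makes the
      -- subtraction exact.
      (μ , x ∸ suc (hook rs) ∷ rs)
      , (pos , dec , cong not ev , trans (moveSum {μ} {x ∸ suc (hook rs)} {rs}) (trans (cong (λ h → h + sum μ + hookSum rs) (sym x≡)) sz))
      , inj₂ (move x≡ x≥)
      where
      x≡ : x ≡ hook (x ∸ suc (hook rs) ∷ rs)
      x≡ = trans (sym (m∸n+n≡m h<x)) (+-suc _ (hook rs))
    partner {z = x ∷ μ , []} (x≥1 ∷ pos , x≥ ∷ dec , ev , sz) | no h≮x = contradiction x≥1 h≮x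
    partner {z = x ∷ μ , r ∷ rs} k@(x≥1 ∷ pos , x≥ ∷ dec , ev , sz) | no h≮x =
      takeHook k (≮⇒≥ h≮x ∷ All.map (λ z≤x → ≤-trans z≤x (≮⇒≥ h≮x)) x≥)

  Avoids≅Meets : ∀ n → 1 ≤ n → Decomposed (Avoids 0) n ≅ Decomposed (Meets 0) n
  Avoids≅Meets n 1≤n = ≅-trans (≅-sym (Hooked≅Decomposed n even⁺ even⁻))
    (≅-trans (toggle n 1≤n) (Hooked≅Decomposed n odd⁺ odd⁻))
    where
    even⁺ : ∀ rs → evenLength rs ≡ true → Avoids 0 (unpeel rs)
    even⁺ rs e = unpeel-avoids rs (subst T (sym e) tt)

    odd⁺ : ∀ rs → evenLength rs ≡ false → Meets 0 (unpeel rs)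
    odd⁺ rs e = unpeel-meets rs (subst (T ∘ not) (sym e) tt)

    -- Avoiding and meeting exclude each other, so each converse follows from the forward direction
    -- for the other parity.
    even⁻ : ∀ rs → Avoids 0 (unpeel rs) → evenLength rs ≡ true
    even⁻ rs a with evenLength rs in e
    ... | true  = refl
    ... | false = contradiction a (meets⇒¬avoids (odd⁺ rs e))

    odd⁻ : ∀ rs → Meets 0 (unpeel rs) → evenLength rs ≡ false
    odd⁻ rs m with evenLength rs in e
    ... | false = refl
    ... | true  = contradiction (even⁺ rs e) (meets⇒¬avoids m)

  -- ρ is left alone, so a change of λ that always adds c to the odd sum adds c to the total size.
  shiftSize : ∀ {D E : List ℕ → Set} (f : List ℕ → List ℕ) c n →
    (∀ {xs} → Decreasing xs → D xs → Decreasing (f xs) × E (f xs) × oddSum (f xs) ≡ c + oddSum xs) →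
    (∀ {xs ys} → D xs → D ys → f xs ≡ f ys → xs ≡ ys) →
    (∀ {ys} → Decreasing ys → E ys → ∃ λ xs → Decreasing xs × D xs × f xs ≡ ys) →
    Decomposed D n ≅ Decomposed E (c + n)
  shiftSize {D} {E} f c n f-ok f-inj f-onto = fromFunction (λ (ρ , xs) → ρ , f xs)
    (λ { {ρ , xs} (r , dec , d , sz) →
         let dec′ , e , sum≡ = f-ok dec d
         in r , dec′ , e , trans (cong (size ρ +_) sum≡) (trans (x∙yz≈y∙xz (size ρ) c (oddSum xs)) (cong (c +_) sz)) })
    (λ { (_ , _ , d , _) (_ , _ , d′ , _) e → cong₂ _,_ (cong proj₁ e) (f-inj d d′ (cong proj₂ e)) })
    λ { {ρ , ys} (r , dec , e , sz) →
        let xs , dec′ , d , fxs≡ = f-onto dec e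
        in (ρ , xs)
         , (r , dec′ , d , +-cancelˡ-≡ c _ _ (trans (sym (x∙yz≈y∙xz (size ρ) c (oddSum xs)))
              (trans (cong (size ρ +_) (trans (sym (proj₂ (proj₂ (f-ok dec′ d)))) (cong oddSum fxs≡))) sz)))
         , cong (ρ ,_) fxs≡ }
    where
    x∙yz≈y∙xz : ∀ x y z → x + (y + z) ≡ y + (x + z)
    x∙yz≈y∙xz = solve 3 (λ x y z → x :+ (y :+ z) := y :+ (x :+ z)) refl

  Avoids≅Meets-suc : ∀ s n → Decomposed (Avoids (suc s)) n ≅ Decomposed (Meets s) (oddPart s + n)
  Avoids≅Meets-suc s n = shiftSize (hit s) (oddPart s) n
    (λ dec a → hit-decreasing dec a , hit-meets a , hit-oddSum a)
    (λ a a′ e → trans (sym (unhit-hit a)) (trans (cong (unhit s) e) (unhit-hit a′)))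
    hit-onto

  -- With s = ν + 1 this is what `M` asks of the odd parts: 1, 3, ..., 2ν + 1 all occur, and the
  -- Durfee condition holds.
  Stacked : ℕ → List ℕ → Set
  Stacked s xs = (∀ {j} → j < s → j ∈ xs) × Avoids s xs

  Avoids≅Stacked : ∀ s n → Decomposed (Avoids s) n ≅ Decomposed (Stacked s) (s * s + n)
  Avoids≅Stacked s n = shiftSize (insertBelow s) (s * s) n
    (λ {xs} dec a → insertBelow-decreasing s dec , (insertBelow-∈ s xs , insertBelow-avoids s ≤-refl a) , insertBelow-oddSum s xs)
    (λ _ _ → insertBelow-injective s)
    λ { dec (has , a) → let xs , dec′ , e = insertBelow-onto s dec has
                        in xs , dec′ , insertBelow-avoids⁻ s xs ≤-refl (subst (Avoids s) (sym e) a) , e }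

  -- From decompositions to Boolean counts.

  Decomposed≅count : ∀ {D : List ℕ → Set} n (q : List (ℕ × Bool) → Bool) →
    (∀ π → T (q π) → Overpartition n π) →
    (∀ {ρ xs} → Rest ρ → Decreasing xs → size ρ + oddSum xs ≡ n → D xs → T (q (join ρ xs))) →
    (∀ {ρ xs} → Rest ρ → Decreasing xs → size ρ + oddSum xs ≡ n → T (q (join ρ xs)) → D xs) →
    Decomposed D n ≅ (T ∘ q)
  Decomposed≅count n q q⇒ q⁺ q⁻ = fromFunction (uncurry join)
    (λ (r , dec , d , sz) → q⁺ r dec sz d)
    (λ { {_ , xs} {_ , ys} (r , _) (r′ , _) e → cong₂ _,_
         (trans (sym (others-join xs r)) (trans (cong others e) (others-join ys r′)))
         (map-injective plainOdd-injective (trans (sym (odds-join xs r)) (trans (cong odds e) (odds-join ys r′)))) })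
    λ {π} t → let over = q⇒ π t
                  ρ , xs , r , dec , e = join-onto over
                  sz = trans (sym (size-join ρ xs)) (trans (cong size e) (proj₂ (proj₂ over)))
              in (ρ , xs) , (r , dec , q⁻ r dec sz (subst (T ∘ q) (sym e) t) , sz) , e

  oddIndices : List (ℕ × Bool) → List ℕ
  oddIndices π = map (λ p → (proj₁ p ∸ 1) / 2) (odds π)

  oddIndices-join : ∀ {ρ} xs → Rest ρ → oddIndices (join ρ xs) ≡ xs
  oddIndices-join xs r = trans (cong (map _) (odds-join xs r))
    (trans (sym (map-∘ xs)) (trans (map-cong half-double xs) (map-id xs)))

  avoiding : ℕ → List (ℕ × Bool) → Bool
  avoiding s π = isYes (avoids? s (oddIndices π))

  -- These are the numbers a(s,n) and b(s,n).
  avoidCount meetCount : ℕ → ℕ → ℕ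
  avoidCount s n = count (λ π → isOverpartition n π ∧ avoiding s π) (overpartitionCands n)
  meetCount  s n = count (λ π → isOverpartition n π ∧ not (avoiding s π)) (overpartitionCands n)

  Avoids≅count : ∀ s n → Decomposed (Avoids s) n ≅ (λ π → T (isOverpartition n π ∧ avoiding s π))
  Avoids≅count s n = Decomposed≅count n _
    (λ π t → isOverpartition⇒ π (proj₁ (Equivalence.to T-∧ t)))
    (λ { {ρ} {xs} r dec refl a → Equivalence.from T-∧
         ( ⇒isOverpartition (join ρ xs) (join-overpartition r dec)
         , fromWitness (subst (Avoids s) (sym (oddIndices-join xs r)) a)) })
    (λ {ρ} {xs} r dec sz t → subst (Avoids s) (oddIndices-join xs r)
         (toWitness (proj₂ (Equivalence.to (T-∧ {isOverpartition n (join ρ xs)}) t))))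

  Meets≅count : ∀ s n → Decomposed (Meets s) n ≅ (λ π → T (isOverpartition n π ∧ not (avoiding s π)))
  Meets≅count s n = Decomposed≅count n _
    (λ π t → isOverpartition⇒ π (proj₁ (Equivalence.to T-∧ t)))
    (λ { {ρ} {xs} r dec refl m → Equivalence.from T-∧
         ( ⇒isOverpartition (join ρ xs) (join-overpartition r dec)
         , fromWitnessFalse (λ a → meets⇒¬avoids m (subst (Avoids s) (oddIndices-join xs r) a))) })
    (λ {ρ} {xs} r dec sz t → meets (avoids-or-meets s xs) λ a →
         toWitnessFalse (proj₂ (Equivalence.to (T-∧ {isOverpartition n (join ρ xs)}) t))
           (subst (Avoids s) (sym (oddIndices-join xs r)) a))
    where
    meets : ∀ {xs} → Avoids s xs ⊎ Meets s xs → ¬ Avoids s xs → Meets s xs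
    meets (inj₁ a) ¬a = contradiction a ¬a
    meets (inj₂ m) _  = m

  count-≅ : ∀ {m n} {p q : List (ℕ × Bool) → Bool} →
    (λ π → T (isOverpartition m π ∧ p π)) ≅ (λ π → T (isOverpartition n π ∧ q π)) →
    count (λ π → isOverpartition m π ∧ p π) (overpartitionCands m)
      ≡ count (λ π → isOverpartition n π ∧ q π) (overpartitionCands n)
  count-≅ {m} {n} = count-cong (overpartitionCands-unique m) (overpartitionCands-unique n) cand cand
    where
    cand : ∀ {n π} {b : Bool} → T (isOverpartition n π ∧ b) → π ∈ overpartitionCands n
    cand {π = π} t =
      let pos , _ , sz = isOverpartition⇒ π (proj₁ (Equivalence.to T-∧ t)) in overpartitionCands-complete pos sz

  -- The Durfee condition in terms of `Avoids`.

  rows : ℕ → List ℕ → List (ℕ × ℕ)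
  rows o []       = []
  rows o (x ∷ xs) = (suc o , suc x) ∷ rows (suc o) xs

  -- The odd part with index x has (2x)/2 + 1 = x + 1 boxes, and rows are numbered from 1, whence
  -- the two successors in `rows`.
  indexedRows-oddPart : ∀ xs → indexedRows 1 2 (map oddPart xs) ≡ rows 0 xs
  indexedRows-oddPart xs = go (λ i → i) 0 xs (λ _ → refl)
    where
    -- `applyUpTo` replaces its function by `f ∘ suc` at each step, so the induction runs over all
    -- `f` that shift by an offset.
    go : ∀ f o xs → (∀ i → f i ≡ o + i) →
      zip (map suc (applyUpTo f (length (map oddPart xs)))) (map (ell 1 2) (map oddPart xs)) ≡ rows o xs
    go f o []       f≡ = refl
    go f o (x ∷ xs) f≡ = cong₂ _∷_
      (cong₂ _,_ (cong suc (trans (f≡ 0) (+-identityʳ o)))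
        (trans (+-comm (2 * x / 2) 1) (cong suc (half-double x))))
      (go (f ∘ suc) (suc o) xs (λ i → trans (f≡ (suc i)) (+-suc o i)))

  -- On a decreasing list, at threshold ν + 1, this is the height t of the (ν + 2)-Durfee rectangle.
  climb : ℕ → List ℕ → ℕ
  climb s [] = 0
  climb s (x ∷ xs) with s <? x
  ... | yes _ = suc (climb (suc s) xs)
  ... | no  _ = 0

  module _ (ν : ℕ) where

    inRectangle : ℕ × ℕ → Bool
    inRectangle il = (proj₁ il + ν + 2) ≤ᵇ proj₂ il

    height : List (ℕ × ℕ) → ℕ
    height ils = foldr _⊔_ 0 (map proj₁ (filter (λ il → T? (inRectangle il)) ils))

    private
      -- Row o + 1 with x + 1 boxes fits when x + 1 ≥ (o + 1) + ν + 2, that is x > o + (ν + 1): the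
      -- strict comparison of `above`.
      threshold : ∀ o → suc o + ν + 2 ≡ suc (suc (o + suc ν))
      threshold = solve 2 (λ v o → con 1 :+ o :+ v :+ con 2 := con 2 :+ (o :+ (con 1 :+ v))) refl ν

    inRectangle⁺ : ∀ {o x} → o + suc ν < x → T (inRectangle (suc o , suc x))
    inRectangle⁺ {o} {x} lt = ≤⇒≤ᵇ (subst (_≤ suc x) (sym (threshold o)) (s≤s lt))

    inRectangle⁻ : ∀ {o x} → T (inRectangle (suc o , suc x)) → o + suc ν < x
    inRectangle⁻ {o} {x} t = s≤s⁻¹ (subst (_≤ suc x) (threshold o) (≤ᵇ⇒≤ _ _ t))

    height-zero : ∀ {o xs} → All (_≤ o + suc ν) xs → height (rows o xs) ≡ 0
    height-zero [] = refl
    height-zero {o} {x ∷ xs} (x≤ ∷ xs≤) = trans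
      (cong (foldr _⊔_ 0 ∘ map proj₁)
        (filter-reject (λ il → T? (inRectangle il)) {suc o , suc x} {rows (suc o) xs} (λ t → <⇒≱ (inRectangle⁻ {o} {x} t) x≤)))
      (height-zero {suc o} (All.map m≤n⇒m≤1+n xs≤))

    -- The maximum with o makes both sides agree when no row fits and `height` falls back to 0. Once
    -- a row fails to fit, sortedness and the rising threshold make all later rows fail.
    height-rows : ∀ o {xs} → Decreasing xs → o ⊔ height (rows o xs) ≡ o + climb (o + suc ν) xs
    height-rows o [] = trans (⊔-identityʳ o) (sym (+-identityʳ o))
    height-rows o {x ∷ xs} (x≥ ∷ dec) with o + suc ν <? x
    ... | yes s<x = begin
      o ⊔ height (rows o (x ∷ xs))
        ≡⟨ cong (λ ils → o ⊔ foldr _⊔_ 0 (map proj₁ ils))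
             (filter-accept (λ il → T? (inRectangle il)) {suc o , suc x} {rows (suc o) xs} (inRectangle⁺ {o} {x} s<x)) ⟩
      o ⊔ (suc o ⊔ height (rows (suc o) xs))
        ≡⟨ sym (⊔-assoc o (suc o) _) ⟩
      (o ⊔ suc o) ⊔ height (rows (suc o) xs)
        ≡⟨ cong (_⊔ height (rows (suc o) xs)) (m≤n⇒m⊔n≡n (n≤1+n o)) ⟩
      suc o ⊔ height (rows (suc o) xs)
        ≡⟨ height-rows (suc o) dec ⟩
      suc o + climb (suc o + suc ν) xs
        ≡⟨ sym (+-suc o _) ⟩
      o + suc (climb (suc o + suc ν) xs) ∎
      where open ≡-Reasoning
    ... | no s≮x = trans
      (cong (o ⊔_) (height-zero (≮⇒≥ s≮x ∷ All.map (λ z≤x → ≤-trans z≤x (≮⇒≥ s≮x)) x≥)))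
      (trans (⊔-identityʳ o) (sym (+-identityʳ o)))

    cleared : ℕ → ℕ × ℕ → Bool
    cleared t il = (proj₁ il ≤ᵇ t) ∨ (proj₂ il <ᵇ (t + ν + 2))

    private
      width : ∀ t → t + ν + 2 ≡ suc (t + suc ν)
      width = solve 2 (λ v t → t :+ v :+ con 2 := con 1 :+ (t :+ (con 1 :+ v))) refl ν

    cleared⁺ : ∀ t {i x} → x < t + suc ν → T (cleared t (i , suc x))
    cleared⁺ t {i} {x} lt = Equivalence.from (T-∨ {i ≤ᵇ t}) (inj₂ (<⇒<ᵇ (subst (suc x <_) (sym (width t)) (s≤s lt))))

    cleared⁻ : ∀ t {x} → T (cleared t (suc t , suc x)) → x < t + suc ν
    cleared⁻ t {x} c with Equivalence.to (T-∨ {suc t ≤ᵇ t}) c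
    ... | inj₁ le = contradiction (≤ᵇ⇒≤ (suc t) t le) (<-irrefl refl)
    ... | inj₂ lt = s≤s⁻¹ (subst (suc x <_) (width t) (<ᵇ⇒< _ _ lt))

    all-cleared : ∀ t o {xs} → All (_< t + suc ν) xs → All (T ∘ cleared t) (rows o xs)
    all-cleared t o []       = []
    all-cleared t o (b ∷ bs) = cleared⁺ t {suc o} b ∷ all-cleared t (suc o) bs

    -- The height t = o + `climb` is constant along the recursion. Rows inside the rectangle pass by
    -- their number; the first row beyond it is `below` the threshold, and sortedness takes the
    -- later ones with it.
    avoids⇒cleared : ∀ o {xs} → Decreasing xs → Avoids (o + suc ν) xs →
      All (T ∘ cleared (o + climb (o + suc ν) xs)) (rows o xs)
    avoids⇒cleared o [] _ = []
    avoids⇒cleared o {x ∷ xs} (x≥ ∷ dec) a with o + suc ν <? x | a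
    ... | yes s<x | below x<s = contradiction x<s (<-asym s<x)
    ... | yes _ | above _ a′ rewrite +-suc o (climb (suc (o + suc ν)) xs) =
      Equivalence.from T-∨ (inj₁ (≤⇒≤ᵇ (m≤m+n (suc o) _))) ∷ avoids⇒cleared (suc o) dec a′
    ... | no s≮x | above s<x _ = contradiction s<x s≮x
    ... | no _ | below x<s rewrite +-identityʳ o =
      all-cleared o o (x<s ∷ All.map (λ z≤x → ≤-<-trans z≤x x<s) x≥)

    cleared⇒avoids : ∀ o xs → All (T ∘ cleared (o + climb (o + suc ν) xs)) (rows o xs) → Avoids (o + suc ν) xs
    cleared⇒avoids o [] _ = end
    cleared⇒avoids o (x ∷ xs) cs with o + suc ν <? x
    cleared⇒avoids o (x ∷ xs) (_ ∷ cs) | yes s<x rewrite +-suc o (climb (suc (o + suc ν)) xs) =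
      above s<x (cleared⇒avoids (suc o) xs cs)
    -- `climb` is 0 here, so this row has number t + 1 and must pass by its width, which excludes an
    -- entry equal to the threshold.
    cleared⇒avoids o (x ∷ xs) (c ∷ _) | no _ rewrite +-identityʳ o = below (cleared⁻ o c)

  durfee-oddPart : ∀ ν {xs} → Decreasing xs → durfeeHeight 1 2 ν (map oddPart xs) ≡ climb (suc ν) xs
  durfee-oddPart ν {xs} dec = trans (cong (height ν) (indexedRows-oddPart xs)) (height-rows ν 0 dec)

  nonincr-oddPart : ∀ {xs} → Decreasing xs → T (nonincr (map oddPart xs))
  nonincr-oddPart [] = tt
  nonincr-oddPart (_∷_ {xs = []} _ _) = tt
  nonincr-oddPart (_∷_ {xs = _ ∷ _} (x≥y ∷ _) dec) =
    Equivalence.from T-∧ (≤⇒≤ᵇ (s≤s (*-monoʳ-≤ 2 x≥y)) , nonincr-oddPart dec)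

  contains⁺ : ∀ {j xs} → j ∈ xs → T (any (λ x → x ≡ᵇ (1 + 2 * j)) (map oddPart xs))
  contains⁺ {j} j∈ = Anyₚ.any⁺ _ (Anyₚ.map⁺ (Any.map (λ { refl → ≡⇒≡ᵇ (oddPart j) _ refl }) j∈))

  contains⁻ : ∀ {j} xs → T (any (λ x → x ≡ᵇ (1 + 2 * j)) (map oddPart xs)) → j ∈ xs
  contains⁻ {j} xs t = Any.map (λ {x} e → sym (oddPart-injective (≡ᵇ⇒≡ (oddPart x) (oddPart j) e)))
    (Anyₚ.map⁻ (Anyₚ.any⁻ _ (map oddPart xs) t))

  clearedRows : ∀ ν xs → Bool
  clearedRows ν xs = all (cleared ν (durfeeHeight 1 2 ν (map oddPart xs))) (indexedRows 1 2 (map oddPart xs))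

  clearedRows≡ : ∀ ν {xs} → Decreasing xs → clearedRows ν xs ≡ all (cleared ν (climb (suc ν) xs)) (rows 0 xs)
  clearedRows≡ ν {xs} dec = cong₂ (λ t → all (cleared ν t)) (durfee-oddPart ν dec) (indexedRows-oddPart xs)

  isM⁺ : ∀ ν {xs} → Decreasing xs → Stacked (suc ν) xs → T (isM 1 2 ν (oddSum xs) (map oddPart xs))
  isM⁺ ν {xs} dec (has , a) = Equivalence.from T-∧
    ( Equivalence.from T-∧
        ( Allₚ.all⁻ _ (Allₚ.map⁺ (All.universal (λ _ → tt) xs))
        , Equivalence.from T-∧ (nonincr-oddPart dec , ≡⇒≡ᵇ (oddSum xs) _ refl))
    , Equivalence.from T-∧
        ( Allₚ.all⁻ _ (Allₚ.map⁺ (All.universal (λ x → ≡⇒≡ᵇ _ 1 (oddPart-isOdd x)) xs))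
        , Equivalence.from T-∧
            ( Allₚ.all⁻ (λ j → any (λ x → x ≡ᵇ (1 + 2 * j)) (map oddPart xs))
                (All.tabulate (λ j∈ → contains⁺ (has (∈-upTo⁻ j∈))))
            , subst T (sym (clearedRows≡ ν dec)) (Allₚ.all⁻ _ (avoids⇒cleared ν 0 dec a)))))

  isM⁻ : ∀ ν N {xs} → Decreasing xs → T (isM 1 2 ν N (map oddPart xs)) → Stacked (suc ν) xs
  isM⁻ ν N {xs} dec t =
    let ps      = map oddPart xs
        _ , t₁  = Equivalence.to (T-∧ {isPartition N ps}) t
        _ , t₂  = Equivalence.to (T-∧ {all (λ x → x % 2 ≡ᵇ 1) ps}) t₁
        h , cl  = Equivalence.to (T-∧ {all (λ j → any (λ x → x ≡ᵇ (1 + 2 * j)) ps) (upTo (suc ν))}) t₂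
    in (λ j< → contains⁻ xs (All.lookup (Allₚ.all⁺ _ (upTo (suc ν)) h) (∈-upTo⁺ j<)))
     , cleared⇒avoids ν 0 xs (Allₚ.all⁺ _ (rows 0 xs) (subst T (clearedRows≡ ν dec) cl))

  oddRestrict : ℕ → ℕ → List (ℕ × Bool) → Bool
  oddRestrict ν n π = isM 1 2 ν (n ∸ size (others π)) (map proj₁ (odds π))

  oddRestrict-join : ∀ ν n {ρ} xs → Rest ρ →
    oddRestrict ν n (join ρ xs) ≡ isM 1 2 ν (n ∸ size ρ) (map oddPart xs)
  oddRestrict-join ν n xs r = cong₂ (λ α ps → isM 1 2 ν (n ∸ α) ps)
    (cong size (others-join xs r)) (trans (cong (map proj₁) (odds-join xs r)) (sym (map-∘ xs)))

  Stacked≅count : ∀ ν n → Decomposed (Stacked (suc ν)) n ≅ (T ∘ isPbar12 ν n)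
  Stacked≅count ν n = Decomposed≅count n (isPbar12 ν n)
    (λ π t → isOverpartition⇒ π (proj₁ (Equivalence.to T-∧ t)))
    (λ { {ρ} {xs} r dec refl st → Equivalence.from T-∧
         ( ⇒isOverpartition (join ρ xs) (join-overpartition r dec)
         , subst T (sym (trans (oddRestrict-join ν n xs r)
             (cong (λ k → isM 1 2 ν k (map oddPart xs)) (m+n∸m≡n (size ρ) (oddSum xs))))) (isM⁺ ν dec st)) })
    (λ {ρ} {xs} r dec sz t → isM⁻ ν (n ∸ size ρ) dec
         (subst T (oddRestrict-join ν n xs r) (proj₂ (Equivalence.to (T-∧ {isOverpartition n (join ρ xs)}) t))))

  -- Recurrences for the counts.

  pbar12-avoidCount : ∀ ν m → pbar12 ν (suc ν * suc ν + m) ≡ avoidCount (suc ν) m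
  pbar12-avoidCount ν m = sym (count-≅
    (≅-trans (≅-sym (Avoids≅count (suc ν) m)) (≅-trans (Avoids≅Stacked (suc ν) m) (Stacked≅count ν _))))

  meetCount-suc : ∀ s m → meetCount s (oddPart s + m) ≡ avoidCount (suc s) m
  meetCount-suc s m = sym (count-≅
    (≅-trans (≅-sym (Avoids≅count (suc s) m)) (≅-trans (Avoids≅Meets-suc s m) (Meets≅count s _))))

  avoidCount≡meetCount : ∀ n → 1 ≤ n → avoidCount 0 n ≡ meetCount 0 n
  avoidCount≡meetCount n 1≤n = count-≅
    (≅-trans (≅-sym (Avoids≅count 0 n)) (≅-trans (Avoids≅Meets n 1≤n) (Meets≅count 0 n)))

  pbar-split : ∀ s n → pbar n ≡ avoidCount s n + meetCount s n
  pbar-split s n = count-split (isOverpartition n) (avoiding s) (overpartitionCands n)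

open import Data.Integer using (ℤ; +_; -_; _+_; _*_) renaming (_^_ to _^ℤ_)
open import Data.Integer.Properties using (pos-+; +-assoc; +-comm; +-identityʳ; *-identityˡ)
import Data.Integer.Solver as ℤSolver
open import Data.List using ([]; _∷_; _∷ʳ_)
open import Data.List.Properties using (map-++; upTo-∷ʳ)
import Data.Nat as ℕ
import Data.Nat.Properties as ℕₚ
import Data.Nat.Solver as ℕSolver
open import Relation.Binary.PropositionalEquality using (refl; sym; trans; cong; cong₂; module ≡-Reasoning)
open Overpartitions using (avoidCount; meetCount; oddPart; pbar-split; avoidCount≡meetCount; meetCount-suc; pbar12-avoidCount)

-- The alternating sum and the induction on ν.

foldr-+-∷ʳ : ∀ xs (y : ℤ) → foldr _+_ (+ 0) (xs ∷ʳ y) ≡ foldr _+_ (+ 0) xs + y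
foldr-+-∷ʳ []       y = +-comm y (+ 0)
foldr-+-∷ʳ (x ∷ xs) y = trans (cong (λ z → x + z) (foldr-+-∷ʳ xs y)) (sym (+-assoc x _ y))

map-suc-upTo-∷ʳ : ∀ (f : ℕ → ℤ) ν → map f (map suc (upTo (suc ν))) ≡ map f (map suc (upTo ν)) ∷ʳ f (suc ν)
map-suc-upTo-∷ʳ f ν = trans (cong (λ is → map f (map suc is)) (sym (upTo-∷ʳ ν)))
  (trans (cong (map f) (map-++ suc (upTo ν) _)) (map-++ f (map suc (upTo ν)) _))

sign-square : ∀ ν → (- + 1) ^ℤ ν * (- + 1) ^ℤ ν ≡ + 1
sign-square 0       = refl
sign-square (suc ν) = trans
  (solve 1 (λ e → (con (- + 1) :* e) :* (con (- + 1) :* e) := e :* e) refl ((- + 1) ^ℤ ν))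
  (sign-square ν)
  where open ℤSolver.+-*-Solver

square : ∀ x → x ^ 2 ≡ x ℕ.* x
square x = cong (x ℕ.*_) (ℕₚ.*-identityʳ x)

next-square : ∀ ν m → suc ν ℕ.* suc ν ℕ.+ m ≡ ν ℕ.* ν ℕ.+ (oddPart ν ℕ.+ m)
next-square = solve 2 (λ v m → (con 1 :+ v) :* (con 1 :+ v) :+ m := v :* v :+ (con 1 :+ con 2 :* v :+ m)) refl
  where open ℕSolver.+-*-Solver

truncated : ℕ → ℕ → ℤ
truncated ν n = + pbar n + (+ 2) * foldr _+_ (+ 0) (map (λ τ → ((- + 1) ^ℤ τ) * + pbar (n ∸ τ ^ 2)) (map suc (upTo ν)))

-- In the step to ν + 1 the previous value is 2b(ν, 2ν + 1 + m) = 2a with a = a(ν + 1, m), and the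
-- new term contributes 2p̄(m) = 2(a + b), so the sign change leaves 2b. The start is p̄(n) = a(0,n)
-- + b(0,n) = 2b(0,n), which needs n ≥ 1.
truncated-meetCount : ∀ ν {n} m → 1 ≤ n → n ≡ ν ℕ.* ν ℕ.+ m →
  ((- + 1) ^ℤ ν) * truncated ν n ≡ (+ 2) * + meetCount ν m
truncated-meetCount 0 m 1≤m refl = begin
  + 1 * (+ pbar m + + 0)
    ≡⟨ trans (*-identityˡ _) (+-identityʳ _) ⟩
  + pbar m
    ≡⟨ cong +_ (trans (pbar-split 0 m) (cong (ℕ._+ meetCount 0 m) (avoidCount≡meetCount m 1≤m))) ⟩
  + (meetCount 0 m ℕ.+ meetCount 0 m)
    ≡⟨ pos-+ (meetCount 0 m) (meetCount 0 m) ⟩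
  + meetCount 0 m + + meetCount 0 m
    ≡⟨ solve 1 (λ b → b :+ b := con (+ 2) :* b) refl (+ meetCount 0 m) ⟩
  + 2 * + meetCount 0 m ∎
  where
  open ≡-Reasoning
  open ℤSolver.+-*-Solver
truncated-meetCount (suc ν) {n} m 1≤n n≡ = begin
  (- + 1 * e) * (+ pbar n + + 2 * foldr _+_ (+ 0) (map f (map suc (upTo (suc ν)))))
    ≡⟨ cong (λ z → (- + 1 * e) * (+ pbar n + + 2 * z))
         (trans (cong (foldr _+_ (+ 0)) (map-suc-upTo-∷ʳ f ν)) (foldr-+-∷ʳ (map f (map suc (upTo ν))) (f (suc ν)))) ⟩
  (- + 1 * e) * (+ pbar n + + 2 * (S + (- + 1 * e) * + pbar (n ∸ suc ν ^ 2)))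
    ≡⟨ cong (λ z → (- + 1 * e) * (+ pbar n + + 2 * (S + (- + 1 * e) * z))) last ⟩
  (- + 1 * e) * (+ pbar n + + 2 * (S + (- + 1 * e) * (a + b)))
    -- The overall sign and that of the new term are both -e, so their product is e², while the old
    -- sum is negated.
    ≡⟨ solve 5 (λ e p s a b →
           (con (- + 1) :* e) :* (p :+ con (+ 2) :* (s :+ (con (- + 1) :* e) :* (a :+ b)))
             := :- (e :* (p :+ con (+ 2) :* s)) :+ con (+ 2) :* ((e :* e) :* (a :+ b)))
         refl e (+ pbar n) S a b ⟩
  - (e * (+ pbar n + + 2 * S)) + + 2 * ((e * e) * (a + b))
    ≡⟨ cong₂ (λ x y → - x + + 2 * (y * (a + b))) previous (sign-square ν) ⟩
  - (+ 2 * a) + + 2 * (+ 1 * (a + b))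
    ≡⟨ solve 2 (λ a b → :- (con (+ 2) :* a) :+ con (+ 2) :* (con (+ 1) :* (a :+ b)) := con (+ 2) :* b)
         refl a b ⟩
  + 2 * b ∎
  where
  open ≡-Reasoning
  open ℤSolver.+-*-Solver
  e = (- + 1) ^ℤ ν
  a = + avoidCount (suc ν) m
  b = + meetCount (suc ν) m

  f : ℕ → ℤ
  f τ = ((- + 1) ^ℤ τ) * + pbar (n ∸ τ ^ 2)

  S = foldr _+_ (+ 0) (map f (map suc (upTo ν)))

  last : + pbar (n ∸ suc ν ^ 2) ≡ a + b
  last = trans (cong (λ k → + pbar k) (trans (cong₂ _∸_ n≡ (square (suc ν))) (ℕₚ.m+n∸m≡n (suc ν ℕ.* suc ν) m)))
    (trans (cong +_ (pbar-split (suc ν) m)) (pos-+ (avoidCount (suc ν) m) (meetCount (suc ν) m)))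

  previous : e * (+ pbar n + + 2 * S) ≡ + 2 * a
  previous = trans (truncated-meetCount ν (oddPart ν ℕ.+ m) 1≤n (trans n≡ (next-square ν m)))
    (cong (λ k → + 2 * + k) (meetCount-suc ν m))

theorem1p7 : (ν n : ℕ) → 1 ≤ ν → (suc ν) ^ 2 ≤ n →
    ((- + 1) ^ℤ ν) * (+ pbar n + (+ 2) * foldr _+_ (+ 0) (map (λ τ → ((- + 1) ^ℤ τ) * + pbar (n ∸ τ ^ 2)) (map suc (upTo ν))))
    ≡ (+ 2) * + pbar12 ν n
theorem1p7 ν n _ ν²≤n = trans
  -- The sum gives 2b(ν, n - ν²). Here n - ν² = (2ν + 1) + m with m = n - (ν + 1)², so this is 2a(ν
  -- + 1, m) = 2p̄(1,2,ν;n).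
  (truncated-meetCount ν (oddPart ν ℕ.+ m) (ℕₚ.≤-trans (ℕ.s≤s ℕ.z≤n) ν²≤n) (trans n≡ (next-square ν m)))
  (cong (λ k → + 2 * + k) (trans (meetCount-suc ν m)
    (trans (sym (pbar12-avoidCount ν m)) (cong (pbar12 ν) (sym n≡)))))
  where
  m = n ∸ suc ν ^ 2
  n≡ : n ≡ suc ν ℕ.* suc ν ℕ.+ m
  n≡ = trans (sym (ℕₚ.m+[n∸m]≡n ν²≤n)) (cong (ℕ._+ m) (square (suc ν)))
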